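{- Let $m,n\ge1$ and let $\lambda\subseteq\nu\subseteq(n-1)^{m-1}$ be partitions. Then $\mathrm{PASM}(\nu/\lambda,m,n)$ is a face of $\mathrm{PASM}(m,n)$, of dimension $|\nu|-|\lambda|$.
   Context: A partition $\mu=(\mu_1\ge\mu_2\ge\cdots)$ is a weakly decreasing sequence of nonnegative integers with finitely many nonzero terms, $|\mu|=\sum_i\mu_i$, and $\ell(\mu)$ is its number of positive parts. We write $\mu\subseteq\nu$ if $\mu_i\le\nu_i$ for all $i$, and $\mu\subseteq a^b$ if $\ell(\mu)\le b$ and $\mu_1\le a$. An $m\times n$ partial alternating sign matrix is an $m\times n$ matrix $M$ with entries in $\{ -1,0,1\}$ such that $\sum_{i'=1}^{i}M_{i'j}\in\{0,1\}$ and $\sum_{j'=1}^{j}M_{ij'}\in\{0,1\}$ for all $i,j$; $\mathrm{PASM}(m,n)$ is the convex hull in $\mathbb{R}^{mn}$ of all $m\times n$ partial alternating sign matrices. For $\mu\subseteq(n-1)^{m-1}$, the $m\times n$ matrix $M^\mu$ has entries $M^\mu_{1,\mu_1+1}=1$; for each $1\le k\le m-1$ with $\mu_k>\mu_{k+1}$, $M^\mu_{k+1,\mu_{k+1}+1}=1$ and $M^\mu_{k+1,\mu_k+1}=-1$; all other entries $0$. $\mathrm{PASM}(\nu/\lambda,m,n)$ is the convex hull in $\mathbb{R}^{mn}$ of $\{M^\mu:\lambda\subseteq\mu\subseteq\nu\}$. -}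

module Defs where

open import Algebra.Bundles.Raw using (RawSemiring)
import Algebra.Definitions.RawMonoid as RawMonoidDefinitions
open import Data.Bool using (if_then_else_)
open import Data.Fin using (Fin; zero; suc; toℕ)
import Data.Fin as Fin
import Data.Fin.Properties as Fin
open import Data.Integer using (ℤ; 0ℤ; 1ℤ; -1ℤ)
import Data.Integer as ℤ
open import Data.List using (List; []; _∷_; applyUpTo; filter; length)
open import Data.List.Membership.Propositional using (_∈_)
import Data.Nat.ListAction as ℕ
open import Data.Nat using (ℕ; suc; _⊔_)
import Data.Nat as ℕ
import Data.Nat.Properties as ℕ
open import Data.Nat.Properties using (m⊔n≤o⇒m≤o; m⊔n≤o⇒n≤o)
open import Data.Product using (Σ-syntax; ∃-syntax; _×_; _,_)
open import Data.Rational using (ℚ; 0ℚ; 1ℚ; ½; ∣_∣; Positive; positive; NonZero; 1/_)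
import Data.Rational as ℚ
import Data.Rational.Properties as ℚ
open import Data.Rational.Solver using (module +-*-Solver)
open import Data.Vec.Functional using (Vector)
open import Level using (0ℓ)
open import Relation.Binary using (Rel)
open import Relation.Binary.PropositionalEquality
  using (_≡_; refl; sym; trans; cong; subst)
open import Relation.Nullary.Decidable using (does)
open import Relation.Unary using (Pred; _≐_)

-- Reals are Cauchy sequences of rationals, compared by a setoid equality.
EventuallyWithin : (ℕ → ℚ) → ℚ → Set
EventuallyWithin x ε = ∃[ N ] (∀ k l → N ℕ.≤ k → N ℕ.≤ l → ∣ x k ℚ.- x l ∣ ℚ.< ε)

IsCauchy : (ℕ → ℚ) → Set
IsCauchy x = ∀ ε → 0ℚ ℚ.< ε → EventuallyWithin x ε

record ℝ : Set where
  constructor mkℝ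
  field
    seq    : ℕ → ℚ
    cauchy : IsCauchy seq

open ℝ public

infix 4 _≈ᴿ_ _≤ᴿ_

record _≈ᴿ_ (x y : ℝ) : Set where
  constructor mk≈
  field
    close : ∀ ε → 0ℚ ℚ.< ε → ∃[ N ] (∀ k → N ℕ.≤ k → ∣ seq x k ℚ.- seq y k ∣ ℚ.< ε)

record _≤ᴿ_ (x y : ℝ) : Set where
  constructor mk≤
  field
    below : ∀ ε → 0ℚ ℚ.< ε → ∃[ N ] (∀ k → N ℕ.≤ k → seq x k ℚ.< seq y k ℚ.+ ε)

fromℚ : ℚ → ℝ
fromℚ p = mkℝ (λ _ → p) λ ε 0<ε → 0 , λ _ _ _ _ →
  subst (λ q → ∣ q ∣ ℚ.< ε) (sym (ℚ.+-inverseʳ p)) 0<ε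

fromℤ : ℤ → ℝ
fromℤ z = fromℚ (z ℚ./ 1)

private
  rearrange-+ : ∀ a b c d →
    (a ℚ.+ b) ℚ.- (c ℚ.+ d) ≡ (a ℚ.- c) ℚ.+ (b ℚ.- d)
  rearrange-+ = solve 4 (λ a b c d →
    (a :+ b) :+ (:- (c :+ d)) := (a :+ (:- c)) :+ (b :+ (:- d))) refl
    where open +-*-Solver

  rearrange-* : ∀ a b c d →
    (a ℚ.* b) ℚ.- (c ℚ.* d) ≡ a ℚ.* (b ℚ.- d) ℚ.+ d ℚ.* (a ℚ.- c)
  rearrange-* = solve 4 (λ a b c d →
    (a :* b) :+ (:- (c :* d)) := a :* (b :+ (:- d)) :+ d :* (a :+ (:- c))) refl
    where open +-*-Solver

  cancel : ∀ a b → b ℚ.+ (a ℚ.- b) ≡ a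
  cancel = solve 2 (λ a b → b :+ (a :+ (:- b)) := a) refl
    where open +-*-Solver

  split-½ : ∀ ε → ½ ℚ.* ε ℚ.+ ½ ℚ.* ε ≡ ε
  split-½ ε = trans (sym (ℚ.*-distribʳ-+ ε ½ ½)) (ℚ.*-identityˡ ε)

  half-pos : ∀ {ε} → 0ℚ ℚ.< ε → 0ℚ ℚ.< ½ ℚ.* ε
  half-pos = ℚ.*-monoʳ-<-pos ½

  +-cauchy : ∀ {x y} → IsCauchy x → IsCauchy y → IsCauchy (λ k → x k ℚ.+ y k)
  +-cauchy {x} {y} cx cy ε 0<ε with cx (½ ℚ.* ε) (half-pos 0<ε) | cy (½ ℚ.* ε) (half-pos 0<ε)
  ... | N , hx | K , hy = N ⊔ K , λ k l N⊔K≤k N⊔K≤l → begin-strict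
      ∣ (x k ℚ.+ y k) ℚ.- (x l ℚ.+ y l) ∣
        ≡⟨ cong ∣_∣ (rearrange-+ (x k) (y k) (x l) (y l)) ⟩
      ∣ (x k ℚ.- x l) ℚ.+ (y k ℚ.- y l) ∣
        ≤⟨ ℚ.∣p+q∣≤∣p∣+∣q∣ (x k ℚ.- x l) (y k ℚ.- y l) ⟩
      ∣ x k ℚ.- x l ∣ ℚ.+ ∣ y k ℚ.- y l ∣
        <⟨ ℚ.+-mono-< (hx k l (m⊔n≤o⇒m≤o N K N⊔K≤k) (m⊔n≤o⇒m≤o N K N⊔K≤l))
                      (hy k l (m⊔n≤o⇒n≤o N K N⊔K≤k) (m⊔n≤o⇒n≤o N K N⊔K≤l)) ⟩
      ½ ℚ.* ε ℚ.+ ½ ℚ.* ε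
        ≡⟨ split-½ ε ⟩
      ε ∎
    where open ℚ.≤-Reasoning

  eventuallyBounded : ∀ {x} → IsCauchy x →
    Σ[ B ∈ ℚ ] Positive B × ∃[ N ] (∀ k → N ℕ.≤ k → ∣ x k ∣ ℚ.≤ B)
  eventuallyBounded {x} cx with cx 1ℚ (ℚ.positive⁻¹ 1ℚ)
  ... | N , h = ∣ x N ∣ ℚ.+ 1ℚ
              , positive (ℚ.+-mono-≤-< (ℚ.0≤∣p∣ (x N)) (ℚ.positive⁻¹ 1ℚ))
              , N , λ k N≤k → begin
      ∣ x k ∣                        ≡⟨ cong ∣_∣ (sym (cancel (x k) (x N))) ⟩
      ∣ x N ℚ.+ (x k ℚ.- x N) ∣      ≤⟨ ℚ.∣p+q∣≤∣p∣+∣q∣ (x N) (x k ℚ.- x N) ⟩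
      ∣ x N ∣ ℚ.+ ∣ x k ℚ.- x N ∣    ≤⟨ ℚ.+-monoʳ-≤ ∣ x N ∣ (ℚ.<⇒≤ (h k N N≤k ℕ.≤-refl)) ⟩
      ∣ x N ∣ ℚ.+ 1ℚ                 ∎
    where open ℚ.≤-Reasoning

  *-bound : ∀ {B δ} a b → Positive B → ∣ a ∣ ℚ.≤ B → ∣ b ∣ ℚ.< δ → ∣ a ℚ.* b ∣ ℚ.< B ℚ.* δ
  *-bound {B} {δ} a b B>0 a≤B b<δ = begin-strict
      ∣ a ℚ.* b ∣      ≡⟨ ℚ.∣p*q∣≡∣p∣*∣q∣ a b ⟩
      ∣ a ∣ ℚ.* ∣ b ∣  ≤⟨ ℚ.*-monoʳ-≤-nonNeg ∣ b ∣ {{ℚ.∣-∣-nonNeg b}} a≤B ⟩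
      B ℚ.* ∣ b ∣      <⟨ ℚ.*-monoʳ-<-pos B {{B>0}} b<δ ⟩
      B ℚ.* δ          ∎
    where open ℚ.≤-Reasoning

  divide : ∀ S ε → Positive S → 0ℚ ℚ.< ε → Σ[ δ ∈ ℚ ] 0ℚ ℚ.< δ × S ℚ.* δ ≡ ε
  divide S ε S>0 0<ε = 1/ S ℚ.* ε , 0<δ , Sδ≡ε
    where
    instance
      S≢0 : NonZero S
      S≢0 = ℚ.pos⇒nonZero S {{S>0}}

    0<δ : 0ℚ ℚ.< 1/ S ℚ.* ε
    0<δ = subst (ℚ._< 1/ S ℚ.* ε) (ℚ.*-zeroʳ (1/ S))
            (ℚ.*-monoʳ-<-pos (1/ S) {{ℚ.1/pos⇒pos S {{S>0}}}} 0<ε)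

    Sδ≡ε : S ℚ.* (1/ S ℚ.* ε) ≡ ε
    Sδ≡ε = trans (sym (ℚ.*-assoc S (1/ S) ε))
             (trans (cong (ℚ._* ε) (ℚ.*-inverseʳ S)) (ℚ.*-identityˡ ε))

  *-close : ∀ {B C δ ε} a b c d → Positive B → Positive C → (B ℚ.+ C) ℚ.* δ ≡ ε →
    ∣ a ∣ ℚ.≤ B → ∣ d ∣ ℚ.≤ C → ∣ b ℚ.- d ∣ ℚ.< δ → ∣ a ℚ.- c ∣ ℚ.< δ →
    ∣ (a ℚ.* b) ℚ.- (c ℚ.* d) ∣ ℚ.< ε
  *-close {B} {C} {δ} {ε} a b c d B>0 C>0 eq a≤B d≤C b-d<δ a-c<δ = begin-strict
      ∣ (a ℚ.* b) ℚ.- (c ℚ.* d) ∣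
        ≡⟨ cong ∣_∣ (rearrange-* a b c d) ⟩
      ∣ a ℚ.* (b ℚ.- d) ℚ.+ d ℚ.* (a ℚ.- c) ∣
        ≤⟨ ℚ.∣p+q∣≤∣p∣+∣q∣ (a ℚ.* (b ℚ.- d)) (d ℚ.* (a ℚ.- c)) ⟩
      ∣ a ℚ.* (b ℚ.- d) ∣ ℚ.+ ∣ d ℚ.* (a ℚ.- c) ∣
        <⟨ ℚ.+-mono-< (*-bound a (b ℚ.- d) B>0 a≤B b-d<δ) (*-bound d (a ℚ.- c) C>0 d≤C a-c<δ) ⟩
      B ℚ.* δ ℚ.+ C ℚ.* δ
        ≡⟨ trans (sym (ℚ.*-distribʳ-+ δ B C)) eq ⟩
      ε ∎
    where open ℚ.≤-Reasoning

  Bounded : (ℕ → ℚ) → ℚ → Set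
  Bounded x B = ∃[ N ] (∀ k → N ℕ.≤ k → ∣ x k ∣ ℚ.≤ B)

  *-close-seq : ∀ x y B C δ ε → Positive B → Positive C → (B ℚ.+ C) ℚ.* δ ≡ ε →
    Bounded x B → Bounded y C → EventuallyWithin x δ → EventuallyWithin y δ → EventuallyWithin (λ k → x k ℚ.* y k) ε
  *-close-seq x y B C δ ε B>0 C>0 eq (N₁ , bx) (N₂ , by) (N₃ , hx) (N₄ , hy) =
    (N₁ ⊔ N₂) ⊔ (N₃ ⊔ N₄) , λ k l N≤k N≤l →
      *-close {B} {C} {δ} {ε} (x k) (y k) (x l) (y l) B>0 C>0 eq
        (bx k (m⊔n≤o⇒m≤o N₁ N₂ (m⊔n≤o⇒m≤o (N₁ ⊔ N₂) (N₃ ⊔ N₄) N≤k)))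
        (by l (m⊔n≤o⇒n≤o N₁ N₂ (m⊔n≤o⇒m≤o (N₁ ⊔ N₂) (N₃ ⊔ N₄) N≤l)))
        (hy k l (m⊔n≤o⇒n≤o N₃ N₄ (m⊔n≤o⇒n≤o (N₁ ⊔ N₂) (N₃ ⊔ N₄) N≤k))
                (m⊔n≤o⇒n≤o N₃ N₄ (m⊔n≤o⇒n≤o (N₁ ⊔ N₂) (N₃ ⊔ N₄) N≤l)))
        (hx k l (m⊔n≤o⇒m≤o N₃ N₄ (m⊔n≤o⇒n≤o (N₁ ⊔ N₂) (N₃ ⊔ N₄) N≤k))
                (m⊔n≤o⇒m≤o N₃ N₄ (m⊔n≤o⇒n≤o (N₁ ⊔ N₂) (N₃ ⊔ N₄) N≤l)))

  *-cauchy : ∀ {x y} → IsCauchy x → IsCauchy y → IsCauchy (λ k → x k ℚ.* y k)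
  *-cauchy {x} {y} cx cy ε 0<ε = choose (eventuallyBounded cx) (eventuallyBounded cy)
    where
    finish : ∀ B C → Positive B → Positive C → Bounded x B → Bounded y C →
      Σ[ δ ∈ ℚ ] 0ℚ ℚ.< δ × (B ℚ.+ C) ℚ.* δ ≡ ε → EventuallyWithin (λ k → x k ℚ.* y k) ε
    finish B C B>0 C>0 bx by (δ , 0<δ , eq) =
      *-close-seq x y B C δ ε B>0 C>0 eq bx by (cx δ 0<δ) (cy δ 0<δ)

    choose : Σ[ B ∈ ℚ ] Positive B × Bounded x B → Σ[ C ∈ ℚ ] Positive C × Bounded y C →
      EventuallyWithin (λ k → x k ℚ.* y k) ε
    choose (B , B>0 , bx) (C , C>0 , by) = finish B C B>0 C>0 bx by
      (divide (B ℚ.+ C) ε (ℚ.pos+pos⇒pos B {{B>0}} C {{C>0}}) 0<ε)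

infixl 6 _+ᴿ_
infixl 7 _*ᴿ_

_+ᴿ_ : ℝ → ℝ → ℝ
x +ᴿ y = mkℝ (λ k → seq x k ℚ.+ seq y k) (+-cauchy {seq x} {seq y} (cauchy x) (cauchy y))

_*ᴿ_ : ℝ → ℝ → ℝ
x *ᴿ y = mkℝ (λ k → seq x k ℚ.* seq y k) (*-cauchy {seq x} {seq y} (cauchy x) (cauchy y))

ℝ-rawSemiring : RawSemiring 0ℓ 0ℓ
ℝ-rawSemiring = record
  { Carrier = ℝ
  ; _≈_     = _≈ᴿ_
  ; _+_     = _+ᴿ_
  ; _*_     = _*ᴿ_
  ; 0#      = fromℚ 0ℚ
  ; 1#      = fromℚ 1ℚ
  }

Matrix : Set → ℕ → ℕ → Set
Matrix A m n = Vector (Vector A n) m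

module ConvexGeometry (R : RawSemiring 0ℓ 0ℓ) (_≤_ : Rel (RawSemiring.Carrier R) 0ℓ) where

  open RawSemiring R
  open RawMonoidDefinitions +-rawMonoid using (sum)

  module _ {m n : ℕ} where

    infix 4 _≋_

    _≋_ : Rel (Matrix Carrier m n) 0ℓ
    x ≋ y = ∀ i j → x i j ≈ y i j

    linearCombination : ∀ {k} → Vector Carrier k → Vector (Matrix Carrier m n) k →
                        Matrix Carrier m n
    linearCombination a p i j = sum (λ s → a s * p s i j)

    conv : Pred (Matrix Carrier m n) 0ℓ → Pred (Matrix Carrier m n) 0ℓ
    conv S x = ∃[ k ] Σ[ a ∈ Vector Carrier k ] Σ[ p ∈ Vector (Matrix Carrier m n) k ]
      (∀ s → S (p s)) × (∀ s → 0# ≤ a s) × sum a ≈ 1# × x ≋ linearCombination a p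

    aff : Pred (Matrix Carrier m n) 0ℓ → Pred (Matrix Carrier m n) 0ℓ
    aff S x = ∃[ k ] Σ[ a ∈ Vector Carrier k ] Σ[ p ∈ Vector (Matrix Carrier m n) k ]
      (∀ s → S (p s)) × sum a ≈ 1# × x ≋ linearCombination a p

    ⟨_,_⟩ : Matrix Carrier m n → Matrix Carrier m n → Carrier
    ⟨ c , x ⟩ = sum (λ i → sum (λ j → c i j * x i j))

    -- Allowing c = 0 counts P itself as a face.
    IsFaceOf : Pred (Matrix Carrier m n) 0ℓ → Pred (Matrix Carrier m n) 0ℓ → Set
    IsFaceOf F P = Σ[ c ∈ Matrix Carrier m n ] Σ[ b ∈ Carrier ]
      (∀ x → P x → ⟨ c , x ⟩ ≤ b) × F ≐ (λ x → P x × ⟨ c , x ⟩ ≈ b)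

    AffinelyIndependent : ∀ {k} → Vector (Matrix Carrier m n) k → Set
    AffinelyIndependent p = ∀ a → sum a ≈ 0# →
      linearCombination a p ≋ (λ _ _ → 0#) → ∀ s → a s ≈ 0#

    -- The affine hull of S has an affine basis of d + 1 points.
    HasDimension : Pred (Matrix Carrier m n) 0ℓ → ℕ → Set
    HasDimension S d = Σ[ p ∈ Vector (Matrix Carrier m n) (suc d) ]
      AffinelyIndependent p × aff (λ x → ∃[ s ] x ≋ p s) ≐ aff S

open ConvexGeometry ℝ-rawSemiring _≤ᴿ_ public

fromℤ-matrix : ∀ {m n} → Matrix ℤ m n → Matrix ℝ m n
fromℤ-matrix M i j = fromℤ (M i j)

-- Indices start at 0: part i is μᵢ₊₁.
record Partition : Set where
  field
    part       : ℕ → ℕ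
    decreasing : ∀ i → part (suc i) ℕ.≤ part i
    bound      : ℕ
    vanishing  : ∀ i → bound ℕ.≤ i → part i ≡ 0

  parts : List ℕ
  parts = applyUpTo part bound

open Partition public using (part)

size : Partition → ℕ
size μ = ℕ.sum (Partition.parts μ)

ℓ : Partition → ℕ
ℓ μ = length (filter (0 ℕ.<?_) (Partition.parts μ))

infix 4 _⊆_ _⊆_^_

_⊆_ : Rel Partition 0ℓ
μ ⊆ ν = ∀ i → part μ i ℕ.≤ part ν i

_⊆_^_ : Partition → ℕ → ℕ → Set
μ ⊆ a ^ b = ℓ μ ℕ.≤ b × part μ 0 ℕ.≤ a

open RawMonoidDefinitions ℤ.+-0-rawMonoid using () renaming (sum to sumℤ)

columnPrefixSum rowPrefixSum : ∀ {m n} → Matrix ℤ m n → Fin m → Fin n → ℤ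
columnPrefixSum M i j = sumℤ (λ i′ → if does (i′ Fin.≤? i) then M i′ j else 0ℤ)
rowPrefixSum    M i j = sumℤ (λ j′ → if does (j′ Fin.≤? j) then M i j′ else 0ℤ)

record IsPartialASM {m n} (M : Matrix ℤ m n) : Set where
  field
    entries : ∀ i j → M i j ∈ -1ℤ ∷ 0ℤ ∷ 1ℤ ∷ []
    columns : ∀ i j → columnPrefixSum M i j ∈ 0ℤ ∷ 1ℤ ∷ []
    rows    : ∀ i j → rowPrefixSum M i j ∈ 0ℤ ∷ 1ℤ ∷ []

PASM : ∀ m n → Pred (Matrix ℝ m n) 0ℓ
PASM m n = conv λ x → Σ[ M ∈ Matrix ℤ m n ] IsPartialASM M × x ≋ fromℤ-matrix M

-- With both indices starting at 0, the entry 1 of the first row is in column μ₁ = part μ 0,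
-- and row suc i compares μₖ = part μ (toℕ i) with μₖ₊₁, where k = toℕ i + 1.
partitionMatrix : Partition → ∀ m n → Matrix ℤ m n
partitionMatrix μ _ _ zero j =
  if does (toℕ j ℕ.≟ part μ 0) then 1ℤ else 0ℤ
partitionMatrix μ _ _ (suc i) j =
  if does (part μ (suc (toℕ i)) ℕ.<? part μ (toℕ i))
  then (if does (toℕ j ℕ.≟ part μ (suc (toℕ i))) then 1ℤ
        else if does (toℕ j ℕ.≟ part μ (toℕ i)) then -1ℤ
        else 0ℤ)
  else 0ℤ

-- PASM(ν/λ, m, n), with κ in place of λ, which Agda reserves.
skewPASM : (ν κ : Partition) → ∀ m n → Pred (Matrix ℝ m n) 0ℓ
skewPASM ν κ m n = conv λ x →
  Σ[ μ ∈ Partition ] κ ⊆ μ × μ ⊆ ν × x ≋ fromℤ-matrix (partitionMatrix μ m n)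

{-# OPTIONS --safe #-}

-- Let Yᵢⱼ be the column prefix sums of a matrix. Those of M^μ are the unit vectors at μᵢ, and
-- M^μ is recovered from them by differences of consecutive rows.
--
-- Face: every partial alternating sign matrix has first row sum ≤ 1, other row sums ≥ 0 and
-- Yᵢⱼ ≥ 0. If these are tight, the last one at all j outside [λᵢ, νᵢ], then every row of Y is a
-- 0-1 vector of sum 1, so a unit vector at some μᵢ in [λᵢ, νᵢ], and nonnegativity of the row
-- prefix sums makes μ decreasing. Hence the sum of these inequalities cuts out the face.
--
-- Dimension: add the boxes of ν/λ one at a time, row by row, giving a chain of |ν| − |λ| + 1
-- partitions μᵗ. The corner sum at the box added in step t is 1 on μˢ for s ≤ t and 0 for s > t,
-- so the M^(μᵗ) are affinely independent. For λ ⊆ μ ⊆ ν, the matrices of μ ∩ μᵗ and μ ∩ μᵗ⁺¹ are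
-- either equal or differ by M^(μᵗ⁺¹) − M^(μᵗ), so M^μ lies in the affine span of the chain.
module Submission where

open import Algebra.Bundles using (CommutativeSemiring)
open import Algebra.Bundles.Raw using (RawSemiring)
import Algebra.Properties.AbelianGroup as AbelianGroupProperties
import Algebra.Properties.CommutativeSemigroup as CommutativeSemigroupProperties
import Algebra.Properties.Semiring.Sum as SemiringSum
open import Algebra.Structures using (IsCommutativeSemiring)
open import Data.Bool using (Bool; true; false; if_then_else_; T; _∧_)
open import Data.Bool.Properties using (T-∧)
open import Data.Empty using (⊥-elim)
open import Data.Fin using (Fin; zero; suc; toℕ; inject₁; fromℕ; fromℕ<)
import Data.Fin as Fin
import Data.Fin.Properties as Fin
open import Data.Integer using (ℤ; +_; 0ℤ; 1ℤ; -1ℤ)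
import Data.Integer as ℤ
import Data.Integer.Properties as ℤ
import Data.Integer.Solver as ℤ-Solver
open import Data.List using ([]; _∷_; applyUpTo; _∷ʳ_; filter; length)
open import Data.List.Membership.Propositional using (_∈_)
import Data.List.Properties as List
open import Data.List.Relation.Unary.Any using (here; there)
import Data.Nat.ListAction as ℕ
import Data.Nat.ListAction.Properties as ℕ
open import Data.Nat
  using (ℕ; zero; suc; _≤_; _<_; z≤n; s≤s; _≡ᵇ_; _≤ᵇ_; _<ᵇ_; _∸_; _⊓_; _⊔_)
import Data.Nat as ℕ
import Data.Nat.Properties as ℕ
open import Data.Nat.Properties using (m⊔n≤o⇒m≤o; m⊔n≤o⇒n≤o)
open import Data.Product using (Σ-syntax; ∃-syntax; _×_; _,_; proj₁; proj₂)
open import Data.Rational using (ℚ; 0ℚ; 1ℚ; ½; ∣_∣)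
import Data.Rational as ℚ
import Data.Rational.Properties as ℚ
import Data.Rational.Solver as ℚ-Solver
import Data.Rational.Unnormalised as ℚᵘ
import Data.Rational.Unnormalised.Properties as ℚᵘ
open import Data.Sum using (_⊎_; inj₁; inj₂)
open import Data.Unit using (tt)
open import Data.Vec.Functional using (Vector; tail) renaming ([] to []ᵥ; _∷_ to _∷ᵥ_)
open import Function using (_∘_; Equivalence)
open import Level using (0ℓ)
open import Relation.Binary using (Rel; IsEquivalence; tri<; tri≈; tri>)
open import Relation.Binary.PropositionalEquality
  using (_≡_; refl; sym; trans; cong; cong₂; subst; subst₂; module ≡-Reasoning)
import Relation.Binary.Reasoning.Setoid as SetoidReasoning
open import Relation.Nullary using (¬_; Dec; yes; no)
open import Relation.Nullary.Decidable using (does)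
open import Relation.Unary using (Pred)
open import Defs

open SemiringSum ℤ.+-*-semiring
  using (sum; sum-cong-≗; ∑-distrib-+; ∑-comm; *-distribˡ-sum; *-distribʳ-sum; sum-replicate-zero)

-- Ordered semiring structure of the reals

Eventually : (ℕ → Set) → Set
Eventually P = ∃[ N ] (∀ k → N ℕ.≤ k → P k)

eventually-map : ∀ {P Q} → (∀ k → P k → Q k) → Eventually P → Eventually Q
eventually-map f (N , h) = N , λ k N≤k → f k (h k N≤k)

eventually-zip : ∀ {P Q R} → (∀ k → P k → Q k → R k) →
  Eventually P → Eventually Q → Eventually R
eventually-zip f (M , g) (N , h) = M ⊔ N , λ k M⊔N≤k →
  f k (g k (m⊔n≤o⇒m≤o M N M⊔N≤k)) (h k (m⊔n≤o⇒n≤o M N M⊔N≤k))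

halves : ∀ ε → ½ ℚ.* ε ℚ.+ ½ ℚ.* ε ≡ ε
halves ε = trans (sym (ℚ.*-distribʳ-+ ε ½ ½)) (ℚ.*-identityˡ ε)

½*-positive : ∀ {ε} → 0ℚ ℚ.< ε → 0ℚ ℚ.< ½ ℚ.* ε
½*-positive = ℚ.*-monoʳ-<-pos ½

<⇒<+ : ∀ p {ε} → 0ℚ ℚ.< ε → p ℚ.< p ℚ.+ ε
<⇒<+ p {ε} 0<ε = subst (ℚ._< p ℚ.+ ε) (ℚ.+-identityʳ p) (ℚ.+-monoʳ-< p 0<ε)

∣p-q∣≡∣q-p∣ : ∀ p q → ∣ p ℚ.- q ∣ ≡ ∣ q ℚ.- p ∣
∣p-q∣≡∣q-p∣ p q = trans (sym (ℚ.∣-p∣≡∣p∣ (p ℚ.- q))) (cong ∣_∣ (flip p q))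
  where
  open ℚ-Solver.+-*-Solver
  flip : ∀ p q → ℚ.- (p ℚ.- q) ≡ q ℚ.- p
  flip = solve 2 (λ p q → :- (p :+ :- q) := q :+ :- p) refl

∣p+q∣<ε : ∀ {p q ε} → ∣ p ∣ ℚ.< ½ ℚ.* ε → ∣ q ∣ ℚ.< ½ ℚ.* ε → ∣ p ℚ.+ q ∣ ℚ.< ε
∣p+q∣<ε {p} {q} {ε} p<ε/2 q<ε/2 = subst (∣ p ℚ.+ q ∣ ℚ.<_) (halves ε)
  (ℚ.≤-<-trans (ℚ.∣p+q∣≤∣p∣+∣q∣ p q) (ℚ.+-mono-< p<ε/2 q<ε/2))

∣p∣<ε⇒p<ε : ∀ {p ε} → ∣ p ∣ ℚ.< ε → p ℚ.< ε
∣p∣<ε⇒p<ε {p} = ℚ.≤-<-trans (p≤∣p∣ p)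
  where
  p≤∣p∣ : ∀ p → p ℚ.≤ ∣ p ∣
  p≤∣p∣ p with ℚ.≤-total 0ℚ p
  ... | inj₁ 0≤p = ℚ.≤-reflexive (sym (ℚ.0≤p⇒∣p∣≡p 0≤p))
  ... | inj₂ p≤0 = ℚ.≤-trans p≤0 (ℚ.0≤∣p∣ p)

pointwise⇒≈ : ∀ {x y} → (∀ k → seq x k ≡ seq y k) → x ≈ᴿ y
pointwise⇒≈ {x} {y} eq = mk≈ λ ε 0<ε → 0 , λ k _ → subst (λ q → ∣ seq x k ℚ.- q ∣ ℚ.< ε) (eq k)
  (subst (λ q → ∣ q ∣ ℚ.< ε) (sym (ℚ.+-inverseʳ (seq x k))) 0<ε)

≈ᴿ-refl : ∀ {x} → x ≈ᴿ x
≈ᴿ-refl = pointwise⇒≈ λ _ → refl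

≈ᴿ-sym : ∀ {x y} → x ≈ᴿ y → y ≈ᴿ x
≈ᴿ-sym {x} {y} (mk≈ x≈y) = mk≈ λ ε 0<ε → eventually-map
  (λ k → subst (ℚ._< ε) (∣p-q∣≡∣q-p∣ (seq x k) (seq y k))) (x≈y ε 0<ε)

≈ᴿ-trans : ∀ {x y z} → x ≈ᴿ y → y ≈ᴿ z → x ≈ᴿ z
≈ᴿ-trans {x} {y} {z} (mk≈ x≈y) (mk≈ y≈z) = mk≈ λ ε 0<ε → eventually-zip
  (λ k p q → subst (λ r → ∣ r ∣ ℚ.< ε) (telescope (seq x k) (seq y k) (seq z k))
    (∣p+q∣<ε {seq x k ℚ.- seq y k} {seq y k ℚ.- seq z k} p q))
  (x≈y _ (½*-positive 0<ε)) (y≈z _ (½*-positive 0<ε))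
  where
  open ℚ-Solver.+-*-Solver
  telescope : ∀ p q r → (p ℚ.- q) ℚ.+ (q ℚ.- r) ≡ p ℚ.- r
  telescope = solve 3 (λ p q r → (p :+ :- q) :+ (q :+ :- r) := p :+ :- r) refl

+ᴿ-cong : ∀ {x y u v} → x ≈ᴿ y → u ≈ᴿ v → x +ᴿ u ≈ᴿ y +ᴿ v
+ᴿ-cong {x} {y} {u} {v} (mk≈ x≈y) (mk≈ u≈v) = mk≈ λ ε 0<ε → eventually-zip
  (λ k p q → subst (λ r → ∣ r ∣ ℚ.< ε) (rearrange (seq x k) (seq y k) (seq u k) (seq v k))
    (∣p+q∣<ε {seq x k ℚ.- seq y k} {seq u k ℚ.- seq v k} p q))
  (x≈y _ (½*-positive 0<ε)) (u≈v _ (½*-positive 0<ε))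
  where
  open ℚ-Solver.+-*-Solver
  rearrange : ∀ p q r s → (p ℚ.- q) ℚ.+ (r ℚ.- s) ≡ (p ℚ.+ r) ℚ.- (q ℚ.+ s)
  rearrange = solve 4 (λ p q r s → (p :+ :- q) :+ (r :+ :- s) := (p :+ r) :+ :- (q :+ s)) refl

eventuallyBounded : ∀ x → Σ[ B ∈ ℚ ] ℚ.Positive B × Eventually (λ k → ∣ seq x k ∣ ℚ.≤ B)
eventuallyBounded x with cauchy x 1ℚ (ℚ.positive⁻¹ 1ℚ)
... | N , h = ∣ seq x N ∣ ℚ.+ 1ℚ
            , ℚ.positive (ℚ.+-mono-≤-< (ℚ.0≤∣p∣ (seq x N)) (ℚ.positive⁻¹ 1ℚ))
            , N , λ k N≤k → begin
    ∣ seq x k ∣                              ≡⟨ cong ∣_∣ (cancel (seq x N) (seq x k)) ⟨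
    ∣ seq x N ℚ.+ (seq x k ℚ.- seq x N) ∣    ≤⟨ ℚ.∣p+q∣≤∣p∣+∣q∣ (seq x N) (seq x k ℚ.- seq x N) ⟩
    ∣ seq x N ∣ ℚ.+ ∣ seq x k ℚ.- seq x N ∣  ≤⟨ ℚ.+-monoʳ-≤ ∣ seq x N ∣ (ℚ.<⇒≤ (h k N N≤k ℕ.≤-refl)) ⟩
    ∣ seq x N ∣ ℚ.+ 1ℚ                       ∎
  where
  open ℚ.≤-Reasoning
  cancel : ∀ p q → p ℚ.+ (q ℚ.- p) ≡ q
  cancel = solve 2 (λ p q → p :+ (q :+ :- p) := q) refl
    where open ℚ-Solver.+-*-Solver

<-divide : ∀ {p q B ε} .{{_ : ℚ.NonZero B}} → ℚ.Positive B →
  p ℚ.< ε ℚ.* ℚ.1/ B → 0ℚ ℚ.≤ p → q ℚ.≤ B → p ℚ.* q ℚ.< ε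
<-divide {p} {q} {B} {ε} B>0 p<ε/B 0≤p q≤B = begin-strict
  p ℚ.* q               ≤⟨ ℚ.*-monoˡ-≤-nonNeg p {{ℚ.nonNegative 0≤p}} q≤B ⟩
  p ℚ.* B               <⟨ ℚ.*-monoˡ-<-pos B {{B>0}} p<ε/B ⟩
  (ε ℚ.* ℚ.1/ B) ℚ.* B  ≡⟨ ℚ.*-assoc ε (ℚ.1/ B) B ⟩
  ε ℚ.* (ℚ.1/ B ℚ.* B)  ≡⟨ cong (ε ℚ.*_) (ℚ.*-inverseˡ B) ⟩
  ε ℚ.* 1ℚ              ≡⟨ ℚ.*-identityʳ ε ⟩
  ε                     ∎
  where open ℚ.≤-Reasoning

-- The difference of the products is `x - y` times `z`. Since `z` is eventually bounded by some
-- positive `B`, it suffices to bring `x` and `y` within `ε / B`.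
*ᴿ-congʳ : ∀ {x y} z → x ≈ᴿ y → x *ᴿ z ≈ᴿ y *ᴿ z
*ᴿ-congʳ {x} {y} z (mk≈ x≈y) = bounded (eventuallyBounded z)
  where
  factor : ∀ p q r → ∣ p ℚ.- q ∣ ℚ.* ∣ r ∣ ≡ ∣ p ℚ.* r ℚ.- q ℚ.* r ∣
  factor p q r = trans (sym (ℚ.∣p*q∣≡∣p∣*∣q∣ (p ℚ.- q) r)) (cong ∣_∣ (expand p q r))
    where
    open ℚ-Solver.+-*-Solver
    expand : ∀ p q r → (p ℚ.- q) ℚ.* r ≡ p ℚ.* r ℚ.- q ℚ.* r
    expand = solve 3 (λ p q r → (p :+ :- q) :* r := p :* r :+ :- (q :* r)) refl
  bounded : Σ[ B ∈ ℚ ] ℚ.Positive B × Eventually (λ k → ∣ seq z k ∣ ℚ.≤ B) → x *ᴿ z ≈ᴿ y *ᴿ z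
  bounded (B , B>0 , z≤B) = mk≈ λ ε 0<ε → eventually-zip
    (λ k p q → subst (ℚ._< ε) (factor (seq x k) (seq y k) (seq z k))
      (<-divide B>0 p (ℚ.0≤∣p∣ (seq x k ℚ.- seq y k)) q))
    (x≈y (ε ℚ.* ℚ.1/ B) (subst (ℚ._< ε ℚ.* ℚ.1/ B) (ℚ.*-zeroˡ (ℚ.1/ B))
      (ℚ.*-monoˡ-<-pos (ℚ.1/ B) {{ℚ.1/pos⇒pos B {{B>0}}}} 0<ε)))
    z≤B
    where
    instance
      B≢0 : ℚ.NonZero B
      B≢0 = ℚ.pos⇒nonZero B {{B>0}}

*ᴿ-comm : ∀ x y → x *ᴿ y ≈ᴿ y *ᴿ x
*ᴿ-comm x y = pointwise⇒≈ λ k → ℚ.*-comm (seq x k) (seq y k)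

*ᴿ-cong : ∀ {x y u v} → x ≈ᴿ y → u ≈ᴿ v → x *ᴿ u ≈ᴿ y *ᴿ v
*ᴿ-cong {x} {y} {u} {v} x≈y u≈v = ≈ᴿ-trans {x *ᴿ u} {y *ᴿ u} (*ᴿ-congʳ {x} {y} u x≈y)
  (≈ᴿ-trans {y *ᴿ u} {u *ᴿ y} (*ᴿ-comm y u)
    (≈ᴿ-trans {u *ᴿ y} {v *ᴿ y} (*ᴿ-congʳ {u} {v} y u≈v) (*ᴿ-comm v y)))

≈ᴿ-isEquivalence : IsEquivalence _≈ᴿ_
≈ᴿ-isEquivalence = record { refl = ≈ᴿ-refl ; sym = ≈ᴿ-sym ; trans = ≈ᴿ-trans }

+ᴿ-*ᴿ-isCommutativeSemiring : IsCommutativeSemiring _≈ᴿ_ _+ᴿ_ _*ᴿ_ (fromℚ 0ℚ) (fromℚ 1ℚ)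
+ᴿ-*ᴿ-isCommutativeSemiring = isCommutativeSemiringˡ record
    { +-isCommutativeMonoid = isCommutativeMonoidˡ record
      { isSemigroup = record
        { isMagma = record { isEquivalence = ≈ᴿ-isEquivalence ; ∙-cong = +ᴿ-cong }
        ; assoc = λ x y z → pointwise⇒≈ λ k → ℚ.+-assoc (seq x k) (seq y k) (seq z k)
        }
      ; identityˡ = λ x → pointwise⇒≈ λ k → ℚ.+-identityˡ (seq x k)
      ; comm = λ x y → pointwise⇒≈ λ k → ℚ.+-comm (seq x k) (seq y k)
      }
    ; *-isCommutativeMonoid = isCommutativeMonoidˡ record
      { isSemigroup = record
        { isMagma = record { isEquivalence = ≈ᴿ-isEquivalence ; ∙-cong = *ᴿ-cong }
        ; assoc = λ x y z → pointwise⇒≈ λ k → ℚ.*-assoc (seq x k) (seq y k) (seq z k)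
        }
      ; identityˡ = λ x → pointwise⇒≈ λ k → ℚ.*-identityˡ (seq x k)
      ; comm = *ᴿ-comm
      }
    ; distribʳ = λ x y z → pointwise⇒≈ λ k → ℚ.*-distribʳ-+ (seq x k) (seq y k) (seq z k)
    ; zeroˡ = λ x → pointwise⇒≈ λ k → ℚ.*-zeroˡ (seq x k)
    }
  where open import Algebra.Structures.Biased _≈ᴿ_

+ᴿ-cancelʳ : ∀ {x y} z → x +ᴿ z ≈ᴿ y +ᴿ z → x ≈ᴿ y
+ᴿ-cancelʳ {x} {y} z (mk≈ h) = mk≈ λ ε 0<ε → eventually-map
  (λ k → subst (λ q → ∣ q ∣ ℚ.< ε) (cancel (seq x k) (seq y k) (seq z k))) (h ε 0<ε)
  where
  open ℚ-Solver.+-*-Solver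
  cancel : ∀ p q r → (p ℚ.+ r) ℚ.- (q ℚ.+ r) ≡ p ℚ.- q
  cancel = solve 3 (λ p q r → (p :+ r) :+ :- (q :+ r) := p :+ :- q) refl

≤ᴿ-reflexive : ∀ {x y} → x ≈ᴿ y → x ≤ᴿ y
≤ᴿ-reflexive {x} {y} (mk≈ x≈y) = mk≤ λ ε 0<ε → eventually-map
  (λ k h → subst (ℚ._< seq y k ℚ.+ ε) (cancel (seq x k) (seq y k))
    (ℚ.+-monoʳ-< (seq y k) (∣p∣<ε⇒p<ε {seq x k ℚ.- seq y k} h)))
  (x≈y ε 0<ε)
  where
  open ℚ-Solver.+-*-Solver
  cancel : ∀ p q → q ℚ.+ (p ℚ.- q) ≡ p
  cancel = solve 2 (λ p q → q :+ (p :+ :- q) := p) refl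

≤ᴿ-trans : ∀ {x y z} → x ≤ᴿ y → y ≤ᴿ z → x ≤ᴿ z
≤ᴿ-trans {x} {y} {z} (mk≤ x≤y) (mk≤ y≤z) = mk≤ λ ε 0<ε → eventually-zip
  (λ k p q → subst (seq x k ℚ.<_)
    (trans (ℚ.+-assoc (seq z k) (½ ℚ.* ε) (½ ℚ.* ε)) (cong (seq z k ℚ.+_) (halves ε)))
    (ℚ.<-trans p (ℚ.+-monoˡ-< (½ ℚ.* ε) q)))
  (x≤y _ (½*-positive 0<ε)) (y≤z _ (½*-positive 0<ε))

+ᴿ-mono-≤ : ∀ {x y u v} → x ≤ᴿ y → u ≤ᴿ v → x +ᴿ u ≤ᴿ y +ᴿ v
+ᴿ-mono-≤ {x} {y} {u} {v} (mk≤ x≤y) (mk≤ u≤v) = mk≤ λ ε 0<ε → eventually-zip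
  (λ k p q → subst (seq x k ℚ.+ seq u k ℚ.<_)
    (trans (rearrange (seq y k) (seq v k) (½ ℚ.* ε)) (cong (seq y k ℚ.+ seq v k ℚ.+_) (halves ε)))
    (ℚ.+-mono-< p q))
  (x≤y _ (½*-positive 0<ε)) (u≤v _ (½*-positive 0<ε))
  where
  open ℚ-Solver.+-*-Solver
  rearrange : ∀ p q r → (p ℚ.+ r) ℚ.+ (q ℚ.+ r) ≡ (p ℚ.+ q) ℚ.+ (r ℚ.+ r)
  rearrange = solve 3 (λ p q r → (p :+ r) :+ (q :+ r) := (p :+ q) :+ (r :+ r)) refl

≤ᴿ-antisym : ∀ {x y} → x ≤ᴿ y → y ≤ᴿ x → x ≈ᴿ y
≤ᴿ-antisym {x} {y} (mk≤ x≤y) (mk≤ y≤x) = mk≈ λ ε 0<ε → eventually-zip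
  (λ k → within (seq x k) (seq y k)) (x≤y ε 0<ε) (y≤x ε 0<ε)
  where
  shift : ∀ {p q ε} → p ℚ.< q ℚ.+ ε → p ℚ.- q ℚ.< ε
  shift {p} {q} {ε} h = subst (p ℚ.- q ℚ.<_) (cancel q ε) (ℚ.+-monoˡ-< (ℚ.- q) h)
    where
    open ℚ-Solver.+-*-Solver
    cancel : ∀ q e → (q ℚ.+ e) ℚ.- q ≡ e
    cancel = solve 2 (λ q e → (q :+ e) :+ :- q := e) refl
  within : ∀ p q {ε} → p ℚ.< q ℚ.+ ε → q ℚ.< p ℚ.+ ε → ∣ p ℚ.- q ∣ ℚ.< ε
  within p q {ε} h g with ℚ.∣p∣≡p∨∣p∣≡-p (p ℚ.- q)
  ... | inj₁ eq = subst (ℚ._< ε) (sym eq) (shift h)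
  ... | inj₂ eq = subst (ℚ._< ε) (sym (trans eq (flip p q))) (shift g)
    where
    open ℚ-Solver.+-*-Solver
    flip : ∀ p q → ℚ.- (p ℚ.- q) ≡ q ℚ.- p
    flip = solve 2 (λ p q → :- (p :+ :- q) := q :+ :- p) refl

-- Integers inside the reals

toℚᵘ-/1 : ∀ z → ℚ.toℚᵘ (z ℚ./ 1) ℚᵘ.≃ ℚᵘ.mkℚᵘ z 0
toℚᵘ-/1 z = ℚ.toℚᵘ-fromℚᵘ (ℚᵘ.mkℚᵘ z 0)

-- The quotient `z / 1` is reduced to lowest terms, so the identity does not hold by computation. It
-- is checked on unnormalised fractions with denominator 1 and carried back.
fromℤ-+ : ∀ a b → fromℤ (a ℤ.+ b) ≈ᴿ fromℤ a +ᴿ fromℤ b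
fromℤ-+ a b = pointwise⇒≈ λ _ → ℚ.toℚᵘ-injective (begin
  ℚ.toℚᵘ ((a ℤ.+ b) ℚ./ 1)                    ≈⟨ toℚᵘ-/1 (a ℤ.+ b) ⟩
  ℚᵘ.mkℚᵘ (a ℤ.+ b) 0                         ≈⟨ ℚᵘ.*≡* (cong (ℤ._* + 1)
                                                   (cong₂ ℤ._+_ (ℤ.*-identityʳ a) (ℤ.*-identityʳ b))) ⟨
  ℚᵘ.mkℚᵘ a 0 ℚᵘ.+ ℚᵘ.mkℚᵘ b 0                ≈⟨ ℚᵘ.+-cong (toℚᵘ-/1 a) (toℚᵘ-/1 b) ⟨
  ℚ.toℚᵘ (a ℚ./ 1) ℚᵘ.+ ℚ.toℚᵘ (b ℚ./ 1)      ≈⟨ ℚ.toℚᵘ-homo-+ (a ℚ./ 1) (b ℚ./ 1) ⟨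
  ℚ.toℚᵘ (a ℚ./ 1 ℚ.+ b ℚ./ 1)                ∎)
  where open ℚᵘ.≃-Reasoning

fromℤ-* : ∀ a b → fromℤ (a ℤ.* b) ≈ᴿ fromℤ a *ᴿ fromℤ b
fromℤ-* a b = pointwise⇒≈ λ _ → ℚ.toℚᵘ-injective (begin
  ℚ.toℚᵘ ((a ℤ.* b) ℚ./ 1)                    ≈⟨ toℚᵘ-/1 (a ℤ.* b) ⟩
  ℚᵘ.mkℚᵘ a 0 ℚᵘ.* ℚᵘ.mkℚᵘ b 0                ≈⟨ ℚᵘ.*-cong (toℚᵘ-/1 a) (toℚᵘ-/1 b) ⟨
  ℚ.toℚᵘ (a ℚ./ 1) ℚᵘ.* ℚ.toℚᵘ (b ℚ./ 1)      ≈⟨ ℚ.toℚᵘ-homo-* (a ℚ./ 1) (b ℚ./ 1) ⟨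
  ℚ.toℚᵘ ((a ℚ./ 1) ℚ.* (b ℚ./ 1))              ∎)
  where open ℚᵘ.≃-Reasoning

-- Iverson brackets

⟦_⟧ : Bool → ℤ
⟦ b ⟧ = if b then 1ℤ else 0ℤ

T⇒≡true : ∀ {b} → T b → b ≡ true
T⇒≡true {true} _ = refl

≤⇒≤ᵇ≡true : ∀ {k l} → k ≤ l → (k ≤ᵇ l) ≡ true
≤⇒≤ᵇ≡true = T⇒≡true ∘ ℕ.≤⇒≤ᵇ

≡ᵇ-refl : ∀ k → (k ≡ᵇ k) ≡ true
≡ᵇ-refl k = T⇒≡true (ℕ.≡⇒≡ᵇ k k refl)

<ᵇ-irrefl : ∀ k → (k <ᵇ k) ≡ false
<ᵇ-irrefl zero    = refl
<ᵇ-irrefl (suc k) = <ᵇ-irrefl k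

-- Prefix sums

-- Structurally recursive form of the masked sums in `columnPrefixSum` and `rowPrefixSum`, suited to
-- induction; `sum-below≡prefix` connects the two.
prefix : ∀ {n} → Vector ℤ n → Fin n → ℤ
prefix f zero    = f zero
prefix f (suc i) = f zero ℤ.+ prefix (tail f) i

prefix-cong : ∀ {n} {f g : Vector ℤ n} → (∀ k → f k ≡ g k) → ∀ i → prefix f i ≡ prefix g i
prefix-cong eq zero    = eq zero
prefix-cong eq (suc i) = cong₂ ℤ._+_ (eq zero) (prefix-cong (eq ∘ suc) i)

suc-≤ᵇ-suc : ∀ k l → (suc k ≤ᵇ suc l) ≡ (k ≤ᵇ l)
suc-≤ᵇ-suc zero    l = refl
suc-≤ᵇ-suc (suc k) l = refl

sum-zero : ∀ {n} {f : Vector ℤ n} → (∀ k → f k ≡ 0ℤ) → sum f ≡ 0ℤ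
sum-zero {n} eq = trans (sum-cong-≗ eq) (sum-replicate-zero n)

sum-below≡prefix : ∀ {n} (f : Vector ℤ n) i →
  sum (λ k → if does (k Fin.≤? i) then f k else 0ℤ) ≡ prefix f i
sum-below≡prefix {suc n} f zero = trans (cong (ℤ._+_ (f zero)) (sum-replicate-zero n))
  (ℤ.+-identityʳ (f zero))
sum-below≡prefix f (suc i) = cong (ℤ._+_ (f zero)) (trans
  (sum-cong-≗ λ k → cong (λ b → if b then f (suc k) else 0ℤ) (suc-≤ᵇ-suc (toℕ k) (toℕ i)))
  (sum-below≡prefix (tail f) i))

prefix-minus : ∀ {n} (f g : Vector ℤ n) i →
  prefix (λ k → f k ℤ.- g k) i ≡ prefix f i ℤ.- prefix g i
prefix-minus f g zero    = refl
prefix-minus f g (suc i) = trans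
  (cong (ℤ._+_ (f zero ℤ.- g zero)) (prefix-minus (tail f) (tail g) i))
  (rearrange (f zero) (g zero) (prefix (tail f) i) (prefix (tail g) i))
  where
  open ℤ-Solver.+-*-Solver
  rearrange : ∀ a b c d → (a ℤ.- b) ℤ.+ (c ℤ.- d) ≡ (a ℤ.+ c) ℤ.- (b ℤ.+ d)
  rearrange = solve 4 (λ a b c d → (a :- b) :+ (c :- d) := (a :+ c) :- (b :+ d)) refl

prefix-+ : ∀ {n} (f g : Vector ℤ n) i →
  prefix (λ k → f k ℤ.+ g k) i ≡ prefix f i ℤ.+ prefix g i
prefix-+ f g zero    = refl
prefix-+ f g (suc i) = trans
  (cong (ℤ._+_ (f zero ℤ.+ g zero)) (prefix-+ (tail f) (tail g) i))
  (rearrange (f zero) (g zero) (prefix (tail f) i) (prefix (tail g) i))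
  where
  open ℤ-Solver.+-*-Solver
  rearrange : ∀ a b c d → (a ℤ.+ b) ℤ.+ (c ℤ.+ d) ≡ (a ℤ.+ c) ℤ.+ (b ℤ.+ d)
  rearrange = solve 4 (λ a b c d → (a :+ b) :+ (c :+ d) := (a :+ c) :+ (b :+ d)) refl

prefix-suc : ∀ {n} (f : Vector ℤ (suc n)) i →
  prefix f (suc i) ≡ prefix f (inject₁ i) ℤ.+ f (suc i)
prefix-suc f zero    = refl
prefix-suc f (suc i) = trans (cong (ℤ._+_ (f zero)) (prefix-suc (tail f) i))
  (sym (ℤ.+-assoc (f zero) (prefix (tail f) (inject₁ i)) (f (suc (suc i)))))

prefix-difference : ∀ {n} (f : Vector ℤ (suc n)) i →
  f (suc i) ≡ prefix f (suc i) ℤ.- prefix f (inject₁ i)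
prefix-difference f i = trans (cancel (prefix f (inject₁ i)) (f (suc i)))
  (cong (ℤ._- prefix f (inject₁ i)) (sym (prefix-suc f i)))
  where
  open ℤ-Solver.+-*-Solver
  cancel : ∀ a b → b ≡ (a ℤ.+ b) ℤ.- a
  cancel = solve 2 (λ a b → b := (a :+ b) :- a) refl

prefix-last : ∀ {n} (f : Vector ℤ (suc n)) → prefix f (fromℕ n) ≡ sum f
prefix-last {zero}  f = sym (ℤ.+-identityʳ (f zero))
prefix-last {suc n} f = cong (ℤ._+_ (f zero)) (prefix-last (tail f))

-- Both sides are the corner sum at `(i , j)`. This lets sums along rows of column prefix sums be
-- read off from the row sums of `M`.
prefix-swap : ∀ {m n} (M : Matrix ℤ m n) i j →
  prefix (λ i′ → prefix (M i′) j) i ≡ prefix (λ j′ → prefix (λ i′ → M i′ j′) i) j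
prefix-swap M zero    j = refl
prefix-swap M (suc i) j = trans
  (cong (ℤ._+_ (prefix (M zero) j)) (prefix-swap (tail M) i j))
  (sym (prefix-+ (M zero) (λ j′ → prefix (λ i′ → M (suc i′) j′) i) j))

prefix-telescope : ∀ {n} (f : Vector ℤ (suc n)) (g : ℕ → ℤ) → f zero ≡ g 0 →
  (∀ i → f (suc i) ≡ g (suc (toℕ i)) ℤ.- g (toℕ i)) → ∀ i → prefix f i ≡ g (toℕ i)
prefix-telescope f g f₀ fₛ zero = f₀
prefix-telescope {suc n} f g f₀ fₛ (suc i) = begin
  f zero ℤ.+ prefix (tail f) i
    -- The tail starts with `g 1 - g 0`, so the induction hypothesis is applied to `g` shifted by
    -- one index and lowered by `g 0`.
    ≡⟨ cong₂ ℤ._+_ f₀ (prefix-telescope (tail f) (λ k → g (suc k) ℤ.- g 0) (fₛ zero)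
         (λ k → trans (fₛ (suc k)) (shift (g 0) (g (suc (suc (toℕ k)))) (g (suc (toℕ k))))) i) ⟩
  g 0 ℤ.+ (g (suc (toℕ i)) ℤ.- g 0)
    ≡⟨ cancel (g 0) (g (suc (toℕ i))) ⟩
  g (suc (toℕ i)) ∎
  where
  open ≡-Reasoning
  open ℤ-Solver.+-*-Solver
  shift : ∀ a b c → b ℤ.- c ≡ (b ℤ.- a) ℤ.- (c ℤ.- a)
  shift = solve 3 (λ a b c → b :- c := (b :- a) :- (c :- a)) refl
  cancel : ∀ a b → a ℤ.+ (b ℤ.- a) ≡ b
  cancel = solve 2 (λ a b → a :+ (b :- a) := b) refl

-- Turns row prefix sums of unit vectors into comparisons of positions, where monotonicity of a
-- partition becomes visible as a sign.
prefix-unit : ∀ {n} p (j : Fin n) → prefix (λ k → ⟦ toℕ k ≡ᵇ p ⟧) j ≡ ⟦ p ≤ᵇ toℕ j ⟧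
prefix-unit zero zero = refl
prefix-unit zero (suc j) = cong (ℤ._+_ 1ℤ) (prefix-zero j)
  where
  prefix-zero : ∀ {n} (j : Fin n) → prefix (λ _ → 0ℤ) j ≡ 0ℤ
  prefix-zero zero    = refl
  prefix-zero (suc j) = cong (ℤ._+_ 0ℤ) (prefix-zero j)
prefix-unit (suc p) zero = refl
prefix-unit (suc p) (suc j) = trans (ℤ.+-identityˡ _) (trans (prefix-unit p j)
  (cong ⟦_⟧ (sym (suc-≤ᵇ-suc p (toℕ j)))))

-- Sums of integers of constant sign

x+y≥0 : ∀ {x y} → x ℤ.≤ 0ℤ → y ℤ.≤ 0ℤ → 0ℤ ℤ.≤ x ℤ.+ y → x ≡ 0ℤ × y ≡ 0ℤ
x+y≥0 {x} {y} x≤0 y≤0 0≤x+y =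
  ℤ.≤-antisym x≤0 (ℤ.≤-trans 0≤x+y (ℤ.≤-trans (ℤ.+-monoʳ-≤ x y≤0) (ℤ.≤-reflexive (ℤ.+-identityʳ x)))) ,
  ℤ.≤-antisym y≤0 (ℤ.≤-trans 0≤x+y (ℤ.≤-trans (ℤ.+-monoˡ-≤ y x≤0) (ℤ.≤-reflexive (ℤ.+-identityˡ y))))

sum≤0 : ∀ {n} {f : Vector ℤ n} → (∀ k → f k ℤ.≤ 0ℤ) → sum f ℤ.≤ 0ℤ
sum≤0 {zero}  h = ℤ.≤-refl
sum≤0 {suc n} h = ℤ.+-mono-≤ (h zero) (sum≤0 (h ∘ suc))

0≤sum : ∀ {n} {f : Vector ℤ n} → (∀ k → 0ℤ ℤ.≤ f k) → 0ℤ ℤ.≤ sum f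
0≤sum {zero}  h = ℤ.≤-refl
0≤sum {suc n} h = ℤ.+-mono-≤ (h zero) (0≤sum (h ∘ suc))

-- This is how tightness of a sum of inequalities is passed on to each single inequality.
sum≥0⇒≡0 : ∀ {n} {f : Vector ℤ n} → (∀ k → f k ℤ.≤ 0ℤ) → 0ℤ ℤ.≤ sum f → ∀ k → f k ≡ 0ℤ
sum≥0⇒≡0 h g zero    = proj₁ (x+y≥0 (h zero) (sum≤0 (h ∘ suc)) g)
sum≥0⇒≡0 h g (suc k) = sum≥0⇒≡0 (h ∘ suc)
  (ℤ.≤-reflexive (sym (proj₂ (x+y≥0 (h zero) (sum≤0 (h ∘ suc)) g)))) k

Bit : ℤ → Set
Bit z = z ∈ 0ℤ ∷ 1ℤ ∷ []

⟦⟧-bit : ∀ b → Bit ⟦ b ⟧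
⟦⟧-bit false = here refl
⟦⟧-bit true  = there (here refl)

bit-case : ∀ {z} → Bit z → z ≡ 0ℤ ⊎ z ≡ 1ℤ
bit-case (here eq)         = inj₁ eq
bit-case (there (here eq)) = inj₂ eq

bit≥0 : ∀ {z} → Bit z → 0ℤ ℤ.≤ z
bit≥0 (here refl)         = ℤ.+≤+ z≤n
bit≥0 (there (here refl)) = ℤ.+≤+ z≤n

bit≤1 : ∀ {z} → Bit z → z ℤ.≤ 1ℤ
bit≤1 (here refl)         = ℤ.+≤+ z≤n
bit≤1 (there (here refl)) = ℤ.+≤+ (s≤s z≤n)

bits-sum≡0 : ∀ {n} (y : Vector ℤ n) → (∀ j → Bit (y j)) → sum y ≡ 0ℤ → ∀ j → y j ≡ 0ℤ
bits-sum≡0 {suc n} y bits eq j with bit-case (bits zero)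
bits-sum≡0 {suc n} y bits eq zero    | inj₁ y₀ = y₀
bits-sum≡0 {suc n} y bits eq (suc j) | inj₁ y₀ = bits-sum≡0 (tail y) (bits ∘ suc)
  (trans (sym (ℤ.+-identityˡ _)) (trans (cong (ℤ._+ sum (tail y)) (sym y₀)) eq)) j
bits-sum≡0 {suc n} y bits eq j       | inj₂ y₁ = ⊥-elim (1≰0 (subst (1ℤ ℤ.≤_) eq
  (subst (λ z → 1ℤ ℤ.≤ z ℤ.+ sum (tail y)) (sym y₁)
    (ℤ.+-monoʳ-≤ 1ℤ (0≤sum (bit≥0 ∘ bits ∘ suc))))))
  where
  1≰0 : ¬ 1ℤ ℤ.≤ 0ℤ
  1≰0 (ℤ.+≤+ ())

-- A leading 0 hands the whole sum to the tail. A leading 1 leaves a tail of sum 0, whose bits must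
-- all vanish.
bits-sum≡1 : ∀ {n} (y : Vector ℤ n) → (∀ j → Bit (y j)) → sum y ≡ 1ℤ →
  Σ[ p ∈ Fin n ] (∀ j → y j ≡ ⟦ toℕ j ≡ᵇ toℕ p ⟧)
bits-sum≡1 {suc n} y bits eq with bit-case (bits zero)
... | inj₁ y₀ = suc p , λ { zero → y₀ ; (suc j) → hp j }
  where
  rest : Σ[ p ∈ Fin n ] (∀ j → y (suc j) ≡ ⟦ toℕ j ≡ᵇ toℕ p ⟧)
  rest = bits-sum≡1 (tail y) (bits ∘ suc)
    (trans (sym (ℤ.+-identityˡ _)) (trans (cong (ℤ._+ sum (tail y)) (sym y₀)) eq))
  p  = proj₁ rest
  hp = proj₂ rest
... | inj₂ y₁ = zero , λ { zero → y₁ ; (suc j) → bits-sum≡0 (tail y) (bits ∘ suc) rest≡0 j }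
  where
  rest≡0 : sum (tail y) ≡ 0ℤ
  rest≡0 = AbelianGroupProperties.∙-cancelˡ ℤ.+-0-abelianGroup 1ℤ (sum (tail y)) 0ℤ
    (trans (cong (ℤ._+ sum (tail y)) (sym y₁)) eq)

-- Staircase matrices

-- The matrix whose column prefix sums in row `i` form the unit vector at `f i`. It takes any
-- function, so that meets of partitions can be used without packaging them as a `Partition`.
staircase : (ℕ → ℕ) → ∀ m n → Matrix ℤ m n
staircase f _ _ zero    j = ⟦ toℕ j ≡ᵇ f 0 ⟧
staircase f _ _ (suc i) j = ⟦ toℕ j ≡ᵇ f (suc (toℕ i)) ⟧ ℤ.- ⟦ toℕ j ≡ᵇ f (toℕ i) ⟧

-- For equal consecutive parts the two brackets cancel, which matches the zero row. For distinct
-- parts no column meets both, so the order of the nested tests does not matter.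
partitionMatrix≡staircase : ∀ μ {m n} i j → partitionMatrix μ m n i j ≡ staircase (part μ) m n i j
partitionMatrix≡staircase μ zero    j = refl
partitionMatrix≡staircase μ (suc i) j = entry (toℕ j) (part μ (suc (toℕ i))) (part μ (toℕ i))
  (Partition.decreasing μ (toℕ i))
  where
  entry : ∀ j b a → b ≤ a →
    (if b <ᵇ a then (if j ≡ᵇ b then 1ℤ else if j ≡ᵇ a then -1ℤ else 0ℤ) else 0ℤ) ≡
    ⟦ j ≡ᵇ b ⟧ ℤ.- ⟦ j ≡ᵇ a ⟧
  entry j b a b≤a with b ℕ.<? a
  ... | no  b≮a rewrite ℕ.≤-antisym b≤a (ℕ.≮⇒≥ b≮a) | <ᵇ-irrefl a = sym (ℤ.+-inverseʳ ⟦ j ≡ᵇ a ⟧)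
  ... | yes b<a rewrite T⇒≡true (ℕ.<⇒<ᵇ b<a) with j ≡ᵇ b in j≡b | j ≡ᵇ a in j≡a
  ... | false | false = refl
  ... | false | true  = refl
  ... | true  | false = refl
  ... | true  | true  = ⊥-elim (ℕ.<⇒≢ b<a (trans
    (sym (ℕ.≡ᵇ⇒≡ j b (subst T (sym j≡b) tt))) (ℕ.≡ᵇ⇒≡ j a (subst T (sym j≡a) tt))))

module _ {m n : ℕ} (f : ℕ → ℕ) where

  staircase-column : ∀ i j → prefix (λ i′ → staircase f (suc m) n i′ j) i ≡ ⟦ toℕ j ≡ᵇ f (toℕ i) ⟧
  staircase-column i j = prefix-telescope _ (λ k → ⟦ toℕ j ≡ᵇ f k ⟧) refl (λ _ → refl) i

  staircase-row₀ : ∀ j → prefix (staircase f (suc m) n zero) j ≡ ⟦ f 0 ≤ᵇ toℕ j ⟧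
  staircase-row₀ j = prefix-unit (f 0) j

  staircase-rowₛ : ∀ i j → prefix (staircase f (suc m) n (suc i)) j ≡
    ⟦ f (suc (toℕ i)) ≤ᵇ toℕ j ⟧ ℤ.- ⟦ f (toℕ i) ≤ᵇ toℕ j ⟧
  staircase-rowₛ i j = trans (prefix-minus (λ k → ⟦ toℕ k ≡ᵇ f (suc (toℕ i)) ⟧) _ j)
    (cong₂ ℤ._-_ (prefix-unit (f (suc (toℕ i))) j) (prefix-unit (f (toℕ i)) j))

-- The value -1 would require `a ≤ c` and `c < b`, against `b ≤ a`.
⟦⟧-mono-bit : ∀ {a b c} → b ≤ a → Bit (⟦ b ≤ᵇ c ⟧ ℤ.- ⟦ a ≤ᵇ c ⟧)
⟦⟧-mono-bit {a} {b} {c} b≤a with b ≤ᵇ c in b≤c | a ≤ᵇ c in a≤c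
... | false | false = here refl
... | true  | false = there (here refl)
... | true  | true  = here refl
... | false | true  = ⊥-elim (subst T (trans (sym (T⇒≡true (ℕ.≤⇒≤ᵇ (ℕ.≤-trans b≤a
  (ℕ.≤ᵇ⇒≤ a c (subst T (sym a≤c) tt)))))) b≤c) tt)

module _ {m n : ℕ} (M : Matrix ℤ m n) where

  column≡prefix : ∀ i j → columnPrefixSum M i j ≡ prefix (λ i′ → M i′ j) i
  column≡prefix i j = sum-below≡prefix (λ i′ → M i′ j) i

  row≡prefix : ∀ i j → rowPrefixSum M i j ≡ prefix (M i) j
  row≡prefix i j = sum-below≡prefix (M i) j

-- Column prefix sums are entries of unit vectors. A row prefix sum below the first row is a
-- difference of two comparison brackets, and it is a bit because the parts decrease.
partitionMatrix-isPartialASM : ∀ μ m n → IsPartialASM (partitionMatrix μ m n)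
partitionMatrix-isPartialASM μ zero n = record { entries = λ () ; columns = λ () ; rows = λ () }
partitionMatrix-isPartialASM μ (suc m) n = record
  { entries = λ i j → subst (_∈ _) (sym (partitionMatrix≡staircase μ i j)) (entry i j)
  ; columns = λ i j → subst Bit (sym (trans (column≡prefix M i j)
      (trans (prefix-cong (λ i′ → partitionMatrix≡staircase μ i′ j) i)
        (staircase-column (part μ) i j))))
      (⟦⟧-bit _)
  ; rows = λ i j → subst Bit (sym (trans (row≡prefix M i j)
      (prefix-cong (partitionMatrix≡staircase μ i) j)))
      (row i j)
  }
  where
  M : Matrix ℤ (suc m) n
  M = partitionMatrix μ (suc m) n
  entry : ∀ i j → staircase (part μ) (suc m) n i j ∈ -1ℤ ∷ 0ℤ ∷ 1ℤ ∷ []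
  entry zero j = there (⟦⟧-bit _)
  entry (suc i) j with toℕ j ≡ᵇ part μ (suc (toℕ i)) | toℕ j ≡ᵇ part μ (toℕ i)
  ... | false | false = there (here refl)
  ... | false | true  = here refl
  ... | true  | false = there (there (here refl))
  ... | true  | true  = there (here refl)
  row : ∀ i j → Bit (prefix (staircase (part μ) (suc m) n i) j)
  row zero    j = subst Bit (sym (staircase-row₀ {m} {n} (part μ) j)) (⟦⟧-bit _)
  row (suc i) j = subst Bit (sym (staircase-rowₛ {m} {n} (part μ) i j))
    (⟦⟧-mono-bit (Partition.decreasing μ (toℕ i)))

-- The supporting functional

ℤ⟨_,_⟩ : ∀ {m n} → Matrix ℤ m n → Matrix ℤ m n → ℤ
ℤ⟨ c , M ⟩ = sum (λ i → sum (λ j → c i j ℤ.* M i j))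

module _ {m n : ℕ} (ε : Vector ℤ m) (β : Matrix ℤ m n) where

  -- The matrix of the functional M ↦ Σ ε_k (row sum k) + Σ β_ij (column prefix sum at i, j).
  functional : Matrix ℤ m n
  functional k j = ε k ℤ.+ sum (λ i → ⟦ does (k Fin.≤? i) ⟧ ℤ.* β i j)

  -- The entry `M k j` contributes to the column prefix sum at `(i , j)` exactly when `k ≤ i`.
  -- Collecting these contributions per entry amounts to exchanging the sums over `k` and `i`.
  functional-value : ∀ M → ℤ⟨ functional , M ⟩ ≡
    sum (λ k → ε k ℤ.* sum (M k)) ℤ.+ sum (λ i → sum (λ j → β i j ℤ.* prefix (λ k → M k j) i))
  functional-value M = begin
    sum (λ k → sum (λ j → functional k j ℤ.* M k j))
      ≡⟨ sum-cong-≗ (λ k → trans (sum-cong-≗ λ j → ℤ.*-distribʳ-+ (M k j) (ε k) (w k j))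
           (∑-distrib-+ (λ j → ε k ℤ.* M k j) _)) ⟩
    sum (λ k → sum (λ j → ε k ℤ.* M k j) ℤ.+ sum (λ j → w k j ℤ.* M k j))
      ≡⟨ ∑-distrib-+ (λ k → sum (λ j → ε k ℤ.* M k j)) _ ⟩
    sum (λ k → sum (λ j → ε k ℤ.* M k j)) ℤ.+ sum (λ k → sum (λ j → w k j ℤ.* M k j))
      ≡⟨ cong₂ ℤ._+_ (sum-cong-≗ λ k → sym (*-distribˡ-sum (ε k) (M k))) transpose ⟩
    sum (λ k → ε k ℤ.* sum (M k)) ℤ.+ sum (λ i → sum (λ j → β i j ℤ.* prefix (λ k → M k j) i)) ∎
    where
    open ≡-Reasoning
    w : Matrix ℤ m n
    w k j = sum (λ i → ⟦ does (k Fin.≤? i) ⟧ ℤ.* β i j)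
    δ : ∀ b x y → (⟦ b ⟧ ℤ.* x) ℤ.* y ≡ x ℤ.* (if b then y else 0ℤ)
    δ true  x y = cong (ℤ._* y) (ℤ.*-identityˡ x)
    δ false x y = sym (ℤ.*-zeroʳ x)
    transpose : sum (λ k → sum (λ j → w k j ℤ.* M k j)) ≡
      sum (λ i → sum (λ j → β i j ℤ.* prefix (λ k → M k j) i))
    transpose = begin
      sum (λ k → sum (λ j → w k j ℤ.* M k j))
        ≡⟨ ∑-comm (λ k j → w k j ℤ.* M k j) ⟩
      sum (λ j → sum (λ k → w k j ℤ.* M k j))
        ≡⟨ sum-cong-≗ (λ j → trans (sum-cong-≗ λ k →
             trans (*-distribʳ-sum {m} (M k j) (λ i → ⟦ does (k Fin.≤? i) ⟧ ℤ.* β i j))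
             (sum-cong-≗ λ i → δ (does (k Fin.≤? i)) (β i j) (M k j)))
             (∑-comm {m} {m} (λ k i → β i j ℤ.* (if does (k Fin.≤? i) then M k j else 0ℤ)))) ⟩
      sum (λ j → sum (λ i → sum (λ k → β i j ℤ.* (if does (k Fin.≤? i) then M k j else 0ℤ))))
        ≡⟨ sum-cong-≗ (λ j → sum-cong-≗ λ i → trans
             (sym (*-distribˡ-sum {m} (β i j) (λ k → if does (k Fin.≤? i) then M k j else 0ℤ)))
             (cong (β i j ℤ.*_) (sum-below≡prefix (λ k → M k j) i))) ⟩
      sum (λ j → sum (λ i → β i j ℤ.* prefix (λ k → M k j) i))
        ≡⟨ ∑-comm (λ j i → β i j ℤ.* prefix (λ k → M k j) i) ⟩
      sum (λ i → sum (λ j → β i j ℤ.* prefix (λ k → M k j) i)) ∎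

-- Integral points of the face

≢⇒≡ᵇ≡false : ∀ {k l} → ¬ k ≡ l → (k ≡ᵇ l) ≡ false
≢⇒≡ᵇ≡false {k} {l} k≢l with k ≡ᵇ l in eq
... | false = refl
... | true  = ⊥-elim (k≢l (ℕ.≡ᵇ⇒≡ k l (subst T (sym eq) tt)))

-- A `Partition` has parts at all indices, while a matrix determines them only for its rows.
extend : ∀ {m} → Vector ℕ m → ℕ → ℕ
extend {zero}  v k       = 0
extend {suc m} v zero    = v zero
extend {suc m} v (suc k) = extend (tail v) k

extend-toℕ : ∀ {m} (v : Vector ℕ m) i → extend v (toℕ i) ≡ v i
extend-toℕ v zero    = refl
extend-toℕ v (suc i) = extend-toℕ (tail v) i

extend-vanishing : ∀ {m} (v : Vector ℕ m) k → m ≤ k → extend v k ≡ 0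
extend-vanishing {zero}  v k       _       = refl
extend-vanishing {suc m} v (suc k) (s≤s h) = extend-vanishing (tail v) k h

extend-decreasing : ∀ {m} (v : Vector ℕ (suc m)) → (∀ i → v (suc i) ≤ v (inject₁ i)) →
  ∀ k → extend v (suc k) ≤ extend v k
extend-decreasing {zero}  v h k       = z≤n
extend-decreasing {suc m} v h zero    = h zero
extend-decreasing {suc m} v h (suc k) = extend-decreasing (tail v) (h ∘ suc) k

extend-≤ : ∀ {m} (v : Vector ℕ m) (g : ℕ → ℕ) → (∀ i → v i ≤ g (toℕ i)) → ∀ k → extend v k ≤ g k
extend-≤ {zero}  v g h k       = z≤n
extend-≤ {suc m} v g h zero    = h zero
extend-≤ {suc m} v g h (suc k) = extend-≤ (tail v) (g ∘ suc) (h ∘ suc) k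

≤-extend : ∀ {m} (v : Vector ℕ m) (g : ℕ → ℕ) → (∀ k → m ≤ k → g k ≡ 0) →
  (∀ i → g (toℕ i) ≤ v i) → ∀ k → g k ≤ extend v k
≤-extend {zero}  v g g₀ h k       = ℕ.≤-reflexive (g₀ k z≤n)
≤-extend {suc m} v g g₀ h zero    = h zero
≤-extend {suc m} v g g₀ h (suc k) = ≤-extend (tail v) (g ∘ suc)
  (λ k m≤k → g₀ (suc k) (s≤s m≤k)) (h ∘ suc) k

z-1≤0 : ∀ {z} → z ℤ.≤ 1ℤ → z ℤ.- 1ℤ ℤ.≤ 0ℤ
z-1≤0 = ℤ.+-monoˡ-≤ -1ℤ

z-1≡0 : ∀ {z} → z ℤ.- 1ℤ ≡ 0ℤ → z ≡ 1ℤ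
z-1≡0 {z} = ℤ.i-j≡0⇒i≡j z 1ℤ

-- The matrices have `suc m` rows and `suc n` columns, so `m` and `n` are the sides of the bounding
-- box of `ν`.
module SupportingFunctional (m n : ℕ) (κ ν : Partition)
  (ν-vanishing : ∀ k → suc m ≤ k → part ν k ≡ 0) (ν₀≤n : part ν 0 ≤ n) (κ⊆ν : κ ⊆ ν) where

  -- The signs orient the row inequalities as upper bounds: the first row sum is at most 1, and the
  -- negatives of the others are at most 0.
  ε : Vector ℤ (suc m)
  ε zero    = 1ℤ
  ε (suc _) = -1ℤ

  allowed : Fin (suc m) → Fin (suc n) → Bool
  allowed i j = (part κ (toℕ i) ≤ᵇ toℕ j) ∧ (toℕ j ≤ᵇ part ν (toℕ i))

  -- A column prefix sum is penalised outside the interval from `κ` to `ν` and is free inside it.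
  β : Matrix ℤ (suc m) (suc n)
  β i j = if allowed i j then 0ℤ else -1ℤ

  normal : Matrix ℤ (suc m) (suc n)
  normal = functional ε β

  private
    Y : Matrix ℤ (suc m) (suc n) → Matrix ℤ (suc m) (suc n)
    Y M i j = prefix (λ k → M k j) i

    βY : Matrix ℤ (suc m) (suc n) → Matrix ℤ (suc m) (suc n)
    βY M i j = β i j ℤ.* Y M i j

  -- Splits the excess over the bound 1 into the excesses of the individual inequalities, each of
  -- which is at most 0 on partial alternating sign matrices.
  normal-slack : ∀ M → ℤ⟨ normal , M ⟩ ℤ.- 1ℤ ≡
    (sum (M zero) ℤ.- 1ℤ) ℤ.+
      (sum (λ k → -1ℤ ℤ.* sum (M (suc k))) ℤ.+ sum (λ i → sum (βY M i)))
  normal-slack M = trans (cong (ℤ._- 1ℤ) (functional-value ε β M))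
    (rearrange (sum (M zero)) (sum (λ k → -1ℤ ℤ.* sum (M (suc k)))) (sum (λ i → sum (βY M i))))
    where
    open ℤ-Solver.+-*-Solver
    rearrange : ∀ a b c → ((1ℤ ℤ.* a ℤ.+ b) ℤ.+ c) ℤ.- 1ℤ ≡ (a ℤ.- 1ℤ) ℤ.+ (b ℤ.+ c)
    rearrange = solve 3 (λ a b c →
      ((con 1ℤ :* a :+ b) :+ c) :- con 1ℤ := (a :- con 1ℤ) :+ (b :+ c)) refl

  module _ {M : Matrix ℤ (suc m) (suc n)} (asm : IsPartialASM M) where

    open IsPartialASM asm

    Y-bit : ∀ i j → Bit (Y M i j)
    Y-bit i j = subst Bit (column≡prefix M i j) (columns i j)

    row-bit : ∀ i j → Bit (prefix (M i) j)
    row-bit i j = subst Bit (row≡prefix M i j) (rows i j)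

    row-sum-bit : ∀ i → Bit (sum (M i))
    row-sum-bit i = subst Bit (prefix-last (M i)) (row-bit i (fromℕ n))

    -row≤0 : ∀ k → -1ℤ ℤ.* sum (M (suc k)) ℤ.≤ 0ℤ
    -row≤0 k = subst (ℤ._≤ 0ℤ) (sym (ℤ.-1*i≡-i (sum (M (suc k)))))
      (ℤ.neg-mono-≤ (bit≥0 (row-sum-bit (suc k))))

    βY≤0 : ∀ i j → βY M i j ℤ.≤ 0ℤ
    βY≤0 i j with allowed i j
    ... | true  = ℤ.≤-refl
    ... | false = subst (ℤ._≤ 0ℤ) (sym (ℤ.-1*i≡-i (Y M i j))) (ℤ.neg-mono-≤ (bit≥0 (Y-bit i j)))

    rest≤0 : sum (λ k → -1ℤ ℤ.* sum (M (suc k))) ℤ.+ sum (λ i → sum (βY M i)) ℤ.≤ 0ℤ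
    rest≤0 = ℤ.+-mono-≤ (sum≤0 -row≤0) (sum≤0 λ i → sum≤0 (βY≤0 i))

    normal≤1 : ℤ⟨ normal , M ⟩ ℤ.≤ 1ℤ
    normal≤1 = ℤ.i-j≤0⇒i≤j (subst (ℤ._≤ 0ℤ) (sym (normal-slack M))
      (ℤ.+-mono-≤ (z-1≤0 (bit≤1 (row-sum-bit zero))) rest≤0))

    module Tight (tight : ℤ⟨ normal , M ⟩ ≡ 1ℤ) where

      private
        slack≡0 : 0ℤ ≡ (sum (M zero) ℤ.- 1ℤ) ℤ.+
          (sum (λ k → -1ℤ ℤ.* sum (M (suc k))) ℤ.+ sum (λ i → sum (βY M i)))
        slack≡0 = trans (cong (ℤ._- 1ℤ) (sym tight)) (normal-slack M)

        -- The excess is 0 and all its summands are nonpositive, so they vanish: first the top row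
        -- is split off, then the remaining rows from the column part.
        first-rest = x+y≥0 (z-1≤0 (bit≤1 (row-sum-bit zero))) rest≤0 (ℤ.≤-reflexive slack≡0)

        rows-columns = x+y≥0 (sum≤0 -row≤0) (sum≤0 λ i → sum≤0 (βY≤0 i))
          (ℤ.≤-reflexive (sym (proj₂ first-rest)))

      row₀≡1 : sum (M zero) ≡ 1ℤ
      row₀≡1 = z-1≡0 (proj₁ first-rest)

      rowₛ≡0 : ∀ k → sum (M (suc k)) ≡ 0ℤ
      rowₛ≡0 k = ℤ.neg-injective (trans (sym (ℤ.-1*i≡-i _))
        (sum≥0⇒≡0 -row≤0 (ℤ.≤-reflexive (sym (proj₁ rows-columns))) k))

      βY≡0 : ∀ i j → βY M i j ≡ 0ℤ
      βY≡0 i j = sum≥0⇒≡0 (βY≤0 i) (ℤ.≤-reflexive (sym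
        (sum≥0⇒≡0 (λ i → sum≤0 (βY≤0 i)) (ℤ.≤-reflexive (sym (proj₂ rows-columns))) i))) j

      -- The sum is the corner sum at the last column. Taken by rows instead, it is the sum of the
      -- row sums of `M` down to row `i`, which are 1, 0, ..., 0.
      Y-sum≡1 : ∀ i → sum (Y M i) ≡ 1ℤ
      Y-sum≡1 i = begin
        sum (Y M i)                           ≡⟨ prefix-last (Y M i) ⟨
        prefix (Y M i) (fromℕ n)              ≡⟨ prefix-swap M i (fromℕ n) ⟨
        prefix (λ k → prefix (M k) (fromℕ n)) i ≡⟨ prefix-cong (λ k → prefix-last (M k)) i ⟩
        -- Telescoping along the constant 1: each later row sum is 0, which is `1ℤ - 1ℤ` by
        -- computation.
        prefix (λ k → sum (M k)) i            ≡⟨ prefix-telescope _ (λ _ → 1ℤ) row₀≡1 rowₛ≡0 i ⟩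
        1ℤ                                    ∎
        where open ≡-Reasoning

      position : ∀ i → Σ[ p ∈ Fin (suc n) ] (∀ j → Y M i j ≡ ⟦ toℕ j ≡ᵇ toℕ p ⟧)
      position i = bits-sum≡1 (Y M i) (Y-bit i) (Y-sum≡1 i)

      column : Vector ℕ (suc m)
      column i = toℕ (proj₁ (position i))

      Y≡ : ∀ i j → Y M i j ≡ ⟦ toℕ j ≡ᵇ column i ⟧
      Y≡ i = proj₂ (position i)

      -- At its own position the unit vector has value 1, so a weight of -1 there would contradict
      -- `βY≡0`.
      column-allowed : ∀ i → T (allowed i (proj₁ (position i)))
      column-allowed i = forced (allowed i p)
        (trans (Y≡ i p) (cong ⟦_⟧ (≡ᵇ-refl (column i)))) (βY≡0 i p)
        where
        p = proj₁ (position i)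
        forced : ∀ b {y} → y ≡ 1ℤ → (if b then 0ℤ else -1ℤ) ℤ.* y ≡ 0ℤ → T b
        forced true  _    _  = tt
        forced false refl ()

      κ≤column : ∀ i → part κ (toℕ i) ≤ column i
      κ≤column i = ℕ.≤ᵇ⇒≤ (part κ (toℕ i)) (column i)
        (proj₁ (Equivalence.to T-∧ (column-allowed i)))

      column≤ν : ∀ i → column i ≤ part ν (toℕ i)
      column≤ν i = ℕ.≤ᵇ⇒≤ (column i) (part ν (toℕ i))
        (proj₂ (Equivalence.to (T-∧ {part κ (toℕ i) ≤ᵇ column i}) (column-allowed i)))

      rowₛ≡ : ∀ i j → M (suc i) j ≡ ⟦ toℕ j ≡ᵇ column (suc i) ⟧ ℤ.- ⟦ toℕ j ≡ᵇ column (inject₁ i) ⟧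
      rowₛ≡ i j = trans (prefix-difference (λ k → M k j) i)
        (cong₂ ℤ._-_ (Y≡ (suc i) j) (Y≡ (inject₁ i) j))

      -- The prefix sum of row `suc i` is evaluated at `p`, the position in the row above. There the
      -- -1 has been counted, and nonnegativity forces the 1 to have been counted as well.
      column-decreasing : ∀ i → column (suc i) ≤ column (inject₁ i)
      column-decreasing i = ℕ.≤ᵇ⇒≤ (column (suc i)) (column (inject₁ i)) (⟦⟧-1≥0
        (subst (0ℤ ℤ.≤_) row (bit≥0 (row-bit (suc i) p))))
        where
        p = proj₁ (position (inject₁ i))
        row : prefix (M (suc i)) p ≡ ⟦ column (suc i) ≤ᵇ column (inject₁ i) ⟧ ℤ.- 1ℤ
        row = begin
          prefix (M (suc i)) p
            ≡⟨ prefix-cong (rowₛ≡ i) p ⟩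
          prefix (λ j → ⟦ toℕ j ≡ᵇ column (suc i) ⟧ ℤ.- ⟦ toℕ j ≡ᵇ toℕ p ⟧) p
            ≡⟨ prefix-minus (λ j → ⟦ toℕ j ≡ᵇ column (suc i) ⟧) _ p ⟩
          prefix (λ j → ⟦ toℕ j ≡ᵇ column (suc i) ⟧) p ℤ.- prefix (λ j → ⟦ toℕ j ≡ᵇ toℕ p ⟧) p
            ≡⟨ cong₂ ℤ._-_ (prefix-unit (column (suc i)) p) (trans (prefix-unit (toℕ p) p)
                 (cong ⟦_⟧ (≤⇒≤ᵇ≡true (ℕ.≤-refl {toℕ p})))) ⟩
          ⟦ column (suc i) ≤ᵇ toℕ p ⟧ ℤ.- 1ℤ ∎
          where open ≡-Reasoning
        ⟦⟧-1≥0 : ∀ {b} → 0ℤ ℤ.≤ ⟦ b ⟧ ℤ.- 1ℤ → T b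
        ⟦⟧-1≥0 {true} _ = tt

      partition : Partition
      partition = record
        { part       = extend column
        ; decreasing = extend-decreasing column column-decreasing
        ; bound      = suc m
        ; vanishing  = extend-vanishing column
        }

      κ⊆partition : κ ⊆ partition
      κ⊆partition = ≤-extend column (part κ)
        -- Below the last row the padding is 0, and so is `κ`, since it lies below `ν`.
        (λ k m<k → ℕ.n≤0⇒n≡0 (subst (part κ k ≤_) (ν-vanishing k m<k) (κ⊆ν k))) κ≤column

      partition⊆ν : partition ⊆ ν
      partition⊆ν = extend-≤ column (part ν) column≤ν

      ≡partitionMatrix : ∀ i j → M i j ≡ partitionMatrix partition (suc m) (suc n) i j
      ≡partitionMatrix i j = trans (entry i j) (sym (partitionMatrix≡staircase partition i j))
        where
        entry : ∀ i j → M i j ≡ staircase (extend column) (suc m) (suc n) i j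
        entry zero    j = Y≡ zero j
        entry (suc i) j = trans (rowₛ≡ i j) (cong₂ (λ a b → ⟦ toℕ j ≡ᵇ a ⟧ ℤ.- ⟦ toℕ j ≡ᵇ b ⟧)
          (sym (extend-toℕ column (suc i)))
          (sym (trans (cong (extend column) (sym (Fin.toℕ-inject₁ i)))
            (extend-toℕ column (inject₁ i)))))

  module _ (μ : Partition) (κ⊆μ : κ ⊆ μ) (μ⊆ν : μ ⊆ ν) where

    private
      M : Matrix ℤ (suc m) (suc n)
      M = partitionMatrix μ (suc m) (suc n)

      N : Matrix ℤ (suc m) (suc n)
      N = staircase (part μ) (suc m) (suc n)

      μ≤n : ∀ k → part μ k ≤ n
      μ≤n zero    = ℕ.≤-trans (μ⊆ν 0) ν₀≤n
      μ≤n (suc k) = ℕ.≤-trans (Partition.decreasing μ k) (μ≤n k)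

      -- Every part is the index of an actual column, so a full row sum counts each unit vector
      -- completely.
      ≤ᵇlast : ∀ k → (part μ k ≤ᵇ toℕ (fromℕ n)) ≡ true
      ≤ᵇlast k = ≤⇒≤ᵇ≡true (subst (part μ k ≤_) (sym (Fin.toℕ-fromℕ n)) (μ≤n k))

      row-sum : ∀ i → sum (M i) ≡ prefix (N i) (fromℕ n)
      row-sum i = trans (sum-cong-≗ (partitionMatrix≡staircase μ i)) (sym (prefix-last (N i)))

      row₀ : sum (M zero) ≡ 1ℤ
      row₀ = trans (row-sum zero) (trans (staircase-row₀ {m} (part μ) (fromℕ n))
        (cong ⟦_⟧ (≤ᵇlast 0)))

      rowₛ : ∀ i → sum (M (suc i)) ≡ 0ℤ
      rowₛ i = trans (row-sum (suc i)) (trans (staircase-rowₛ {m} (part μ) i (fromℕ n))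
        (cong₂ (λ a b → ⟦ a ⟧ ℤ.- ⟦ b ⟧) (≤ᵇlast (suc (toℕ i))) (≤ᵇlast (toℕ i))))

      allowed-μ : ∀ i j → toℕ j ≡ part μ (toℕ i) → allowed i j ≡ true
      allowed-μ i j eq = cong₂ _∧_
        (≤⇒≤ᵇ≡true (subst (part κ (toℕ i) ≤_) (sym eq) (κ⊆μ (toℕ i))))
        (≤⇒≤ᵇ≡true (subst (_≤ part ν (toℕ i)) (sym eq) (μ⊆ν (toℕ i))))

      βY≡0 : ∀ i j → βY M i j ≡ 0ℤ
      βY≡0 i j = trans (cong (β i j ℤ.*_)
        (trans (prefix-cong (λ k → partitionMatrix≡staircase μ k j) i)
          (staircase-column (part μ) i j)))
        unit
        where
        unit : β i j ℤ.* ⟦ toℕ j ≡ᵇ part μ (toℕ i) ⟧ ≡ 0ℤ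
        unit with toℕ j ℕ.≟ part μ (toℕ i)
        ... | yes eq = trans (cong (λ b → (if b then 0ℤ else -1ℤ) ℤ.* _) (allowed-μ i j eq)) refl
        ... | no ¬eq = trans (cong (λ b → β i j ℤ.* ⟦ b ⟧) (≢⇒≡ᵇ≡false ¬eq)) (ℤ.*-zeroʳ (β i j))

    -- Every summand of `normal-slack` vanishes: the row sums are 1, 0, ..., 0, and each column
    -- prefix sum is either 0 or sits at the allowed position `part μ (toℕ i)`.
    normal-partitionMatrix : ℤ⟨ normal , partitionMatrix μ (suc m) (suc n) ⟩ ≡ 1ℤ
    normal-partitionMatrix = z-1≡0 (trans (normal-slack M) (cong₂ ℤ._+_ (cong (ℤ._- 1ℤ) row₀)
      (cong₂ ℤ._+_ (sum-zero λ i → cong (-1ℤ ℤ.*_) (rowₛ i)) (sum-zero λ i → sum-zero (βY≡0 i)))))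

-- Chains of partitions

≰⇒≤ᵇ≡false : ∀ {k l} → ¬ k ≤ l → (k ≤ᵇ l) ≡ false
≰⇒≤ᵇ≡false {k} {l} k≰l with k ≤ᵇ l in eq
... | false = refl
... | true  = ⊥-elim (k≰l (ℕ.≤ᵇ⇒≤ k l (subst T (sym eq) tt)))

total : (ℕ → ℕ) → ℕ → ℕ
total f zero    = 0
total f (suc k) = total f k ℕ.+ f k

total-mono : ∀ f {k l} → k ≤ l → total f k ≤ total f l
total-mono f {k} {l} k≤l with ℕ.≤⇒≤′ k≤l
... | ℕ.≤′-reflexive refl = ℕ.≤-refl
... | ℕ.≤′-step k≤′l      = ℕ.≤-trans (total-mono f (ℕ.≤′⇒≤ k≤′l)) (ℕ.m≤m+n _ _)

total-vanishing : ∀ f k → (∀ l → k ≤ l → f l ≡ 0) → ∀ l → total f (l ℕ.+ k) ≡ total f k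
total-vanishing f k f₀ zero    = refl
total-vanishing f k f₀ (suc l) = trans
  (cong₂ ℕ._+_ (total-vanishing f k f₀ l) (f₀ (l ℕ.+ k) (ℕ.m≤n+m k l))) (ℕ.+-identityʳ _)

sum-applyUpTo : ∀ f k → ℕ.sum (applyUpTo f k) ≡ total f k
sum-applyUpTo f zero    = refl
sum-applyUpTo f (suc k) = begin
  ℕ.sum (applyUpTo f (suc k))           ≡⟨ cong ℕ.sum (List.applyUpTo-∷ʳ f k) ⟨
  ℕ.sum (applyUpTo f k ∷ʳ f k) ≡⟨ ℕ.sum-++ (applyUpTo f k) (f k ∷ []) ⟩
  ℕ.sum (applyUpTo f k) ℕ.+ (f k ℕ.+ 0) ≡⟨ cong₂ ℕ._+_ (sum-applyUpTo f k) (ℕ.+-identityʳ (f k)) ⟩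
  total f k ℕ.+ f k                     ∎
  where open ≡-Reasoning

-- The cutoff `bound` stored in `μ` and the cutoff `k` need not be comparable in a known way, so
-- both sums are extended to the common cutoff `k + bound`.
size≡total : ∀ μ k → (∀ l → k ≤ l → part μ l ≡ 0) → size μ ≡ total (part μ) k
size≡total μ k μ₀ = begin
  size μ                       ≡⟨ sum-applyUpTo (part μ) bound ⟩
  total (part μ) bound         ≡⟨ total-vanishing (part μ) bound vanishing k ⟨
  total (part μ) (k ℕ.+ bound) ≡⟨ cong (total (part μ)) (ℕ.+-comm k bound) ⟩
  total (part μ) (bound ℕ.+ k) ≡⟨ total-vanishing (part μ) k μ₀ bound ⟩
  total (part μ) k             ∎
  where
  open ≡-Reasoning
  open Partition μ using (bound; vanishing)

decreasing⇒≤ : ∀ {f : ℕ → ℕ} → (∀ k → f (suc k) ≤ f k) → ∀ {k l} → k ≤ l → f l ≤ f k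
decreasing⇒≤ f↘ {k} {l} k≤l with ℕ.≤⇒≤′ k≤l
... | ℕ.≤′-reflexive refl = ℕ.≤-refl
... | ℕ.≤′-step {l′} k≤′l = ℕ.≤-trans (f↘ l′) (decreasing⇒≤ f↘ (ℕ.≤′⇒≤ k≤′l))

-- If the first value is 0, monotonicity makes all later ones 0. If it is positive, it uses up one
-- unit of the count. The alternative `b ≤ k` covers indices past the list, about which the count
-- says nothing.
support-bound : ∀ (f : ℕ → ℕ) → (∀ k → f (suc k) ≤ f k) → ∀ b k →
  length (filter (0 ℕ.<?_) (applyUpTo f b)) ≤ k → f k ≡ 0 ⊎ b ≤ k
support-bound f f↘ zero    k h = inj₂ z≤n
support-bound f f↘ (suc b) k h with 0 ℕ.<? f 0
... | no f₀≯0 = inj₁ (ℕ.n≤0⇒n≡0 (ℕ.≤-trans (decreasing⇒≤ {f} f↘ {0} {k} z≤n) (ℕ.≮⇒≥ f₀≯0)))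
... | yes f₀>0 with k | subst (λ xs → length xs ≤ k) (List.filter-accept (0 ℕ.<?_) f₀>0) h
... | suc k′ | s≤s h′ with support-bound (f ∘ suc) (f↘ ∘ suc) b k′ h′
... | inj₁ eq  = inj₁ eq
... | inj₂ b≤k = inj₂ (s≤s b≤k)

ℓ≤⇒vanishing : ∀ μ k → ℓ μ ≤ k → ∀ l → k ≤ l → part μ l ≡ 0
ℓ≤⇒vanishing μ k h l k≤l = ℕ.n≤0⇒n≡0 (ℕ.≤-trans (decreasing⇒≤ decreasing k≤l)
  (ℕ.≤-reflexive (at-k (support-bound (part μ) decreasing bound k h))))
  where
  open Partition μ using (decreasing; bound; vanishing)
  at-k : part μ k ≡ 0 ⊎ bound ≤ k → part μ k ≡ 0
  at-k (inj₁ eq) = eq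
  at-k (inj₂ b≤k) = vanishing k b≤k

staircase-cong : ∀ {m n f g} → (∀ k → k < m → f k ≡ g k) → ∀ i j →
  staircase f m n i j ≡ staircase g m n i j
staircase-cong eq zero    j = cong (λ a → ⟦ toℕ j ≡ᵇ a ⟧) (eq 0 (s≤s z≤n))
staircase-cong eq (suc i) j = cong₂ (λ a b → ⟦ toℕ j ≡ᵇ a ⟧ ℤ.- ⟦ toℕ j ≡ᵇ b ⟧)
  (eq (suc (toℕ i)) (s≤s (Fin.toℕ<n i))) (eq (toℕ i) (ℕ.m<n⇒m<1+n (Fin.toℕ<n i)))

-- At each index either nothing moves, or `f` moves exactly as `h` does. The identity is then
-- immediate for unit vectors, and it passes to staircases because these are differences of
-- consecutive unit vectors.
staircase-shift : ∀ {m n} {f′ f h′ h : ℕ → ℕ} →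
  (∀ k → (f′ k ≡ f k × h′ k ≡ h k) ⊎ (f′ k ≡ h′ k × f k ≡ h k)) → ∀ i j →
  staircase f′ m n i j ≡ staircase f m n i j ℤ.+ (staircase h′ m n i j ℤ.- staircase h m n i j)
staircase-shift {f′ = f′} {f} {h′} {h} eq = λ
  { zero    j → unit j 0
  ; (suc i) j → trans (cong₂ ℤ._-_ (unit j (suc (toℕ i))) (unit j (toℕ i)))
      (rearrange (⟦ toℕ j ≡ᵇ f (suc (toℕ i)) ⟧) (⟦ toℕ j ≡ᵇ h′ (suc (toℕ i)) ⟧)
        (⟦ toℕ j ≡ᵇ h (suc (toℕ i)) ⟧)
        (⟦ toℕ j ≡ᵇ f (toℕ i) ⟧) (⟦ toℕ j ≡ᵇ h′ (toℕ i) ⟧) (⟦ toℕ j ≡ᵇ h (toℕ i) ⟧))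
  }
  where
  open ℤ-Solver.+-*-Solver using (solve; _:=_; _:+_; _:-_)
  same : ∀ x y → x ≡ x ℤ.+ (y ℤ.- y)
  same = solve 2 (λ x y → x := x :+ (y :- y)) refl
  moved : ∀ x y → x ≡ y ℤ.+ (x ℤ.- y)
  moved = solve 2 (λ x y → x := y :+ (x :- y)) refl
  rearrange : ∀ a b c d e g → (a ℤ.+ (b ℤ.- c)) ℤ.- (d ℤ.+ (e ℤ.- g)) ≡
    (a ℤ.- d) ℤ.+ ((b ℤ.- e) ℤ.- (c ℤ.- g))
  rearrange = solve 6 (λ a b c d e g →
    (a :+ (b :- c)) :- (d :+ (e :- g)) := (a :- d) :+ ((b :- e) :- (c :- g))) refl
  unit : ∀ {n} (j : Fin n) k →
    ⟦ toℕ j ≡ᵇ f′ k ⟧ ≡ ⟦ toℕ j ≡ᵇ f k ⟧ ℤ.+ (⟦ toℕ j ≡ᵇ h′ k ⟧ ℤ.- ⟦ toℕ j ≡ᵇ h k ⟧)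
  unit j k with eq k
  ... | inj₁ (p , q) rewrite p | q = same ⟦ toℕ j ≡ᵇ f k ⟧ ⟦ toℕ j ≡ᵇ h k ⟧
  ... | inj₂ (p , q) rewrite p | q = moved ⟦ toℕ j ≡ᵇ h′ k ⟧ ⟦ toℕ j ≡ᵇ h k ⟧

-- The saturated chain from κ to ν that adds the boxes of ν/κ row by row.
module Chain (κ ν : Partition) (κ⊆ν : κ ⊆ ν) where

  width : ℕ → ℕ
  width i = part ν i ∸ part κ i

  -- The number of boxes of `ν/κ` above row `i`; row `i` receives its boxes in the steps `t` with
  -- `offset i ≤ t < offset (suc i)`.
  offset : ℕ → ℕ
  offset = total width

  -- Truncated subtraction and the minimum clamp the number of boxes already added in row `i`
  -- between 0 and `width i`.
  chainPart : ℕ → ℕ → ℕ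
  chainPart t i = part κ i ℕ.+ ((t ∸ offset i) ⊓ width i)

  κ≤chainPart : ∀ t i → part κ i ≤ chainPart t i
  κ≤chainPart t i = ℕ.m≤m+n _ _

  κ+width≡ν : ∀ i → part κ i ℕ.+ width i ≡ part ν i
  κ+width≡ν i = ℕ.m+[n∸m]≡n (κ⊆ν i)

  chainPart≤ν : ∀ t i → chainPart t i ≤ part ν i
  chainPart≤ν t i = ℕ.≤-trans (ℕ.+-monoʳ-≤ (part κ i) (ℕ.m⊓n≤n (t ∸ offset i) (width i)))
    (ℕ.≤-reflexive (κ+width≡ν i))

  chainPart-mono : ∀ {s t} → s ≤ t → ∀ i → chainPart s i ≤ chainPart t i
  chainPart-mono s≤t i = ℕ.+-monoʳ-≤ (part κ i) (ℕ.⊓-monoˡ-≤ (width i) (ℕ.∸-monoˡ-≤ (offset i) s≤t))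

  before : ∀ {t i} → t ≤ offset i → chainPart t i ≡ part κ i
  before {t} {i} h = trans (cong (λ k → part κ i ℕ.+ (k ⊓ width i)) (ℕ.m≤n⇒m∸n≡0 h))
    (ℕ.+-identityʳ _)

  after : ∀ {t i} → offset (suc i) ≤ t → chainPart t i ≡ part ν i
  after {t} {i} h = trans (cong (part κ i ℕ.+_) (ℕ.m≥n⇒m⊓n≡n (ℕ.m+n≤o⇒m≤o∸n (width i)
    (subst (_≤ t) (ℕ.+-comm (offset i) (width i)) h)))) (κ+width≡ν i)

  step : ∀ {t i} → offset i ≤ t → t < offset (suc i) → chainPart (suc t) i ≡ suc (chainPart t i)
  step {t} {i} lo hi = begin
    part κ i ℕ.+ ((suc t ∸ offset i) ⊓ width i)
      ≡⟨ cong (λ k → part κ i ℕ.+ (k ⊓ width i)) (ℕ.+-∸-assoc 1 lo) ⟩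
    part κ i ℕ.+ (suc (t ∸ offset i) ⊓ width i)
      ≡⟨ cong (part κ i ℕ.+_) (ℕ.m≤n⇒m⊓n≡m t<width) ⟩
    part κ i ℕ.+ suc (t ∸ offset i)
      ≡⟨ ℕ.+-suc (part κ i) (t ∸ offset i) ⟩
    suc (part κ i ℕ.+ (t ∸ offset i))
      ≡⟨ cong (λ k → suc (part κ i ℕ.+ k)) (ℕ.m≤n⇒m⊓n≡m (ℕ.<⇒≤ t<width)) ⟨
    suc (chainPart t i) ∎
    where
    open ≡-Reasoning
    t<width : t ∸ offset i < width i
    t<width = ℕ.+-cancelʳ-< (offset i) _ _
      (subst₂ _<_ (sym (ℕ.m∸n+n≡m lo)) (ℕ.+-comm (offset i) (width i)) hi)

  stays : ∀ {t i} → offset i ≤ t → t < offset (suc i) → ∀ k → ¬ k ≡ i →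
    chainPart (suc t) k ≡ chainPart t k
  stays {t} {i} lo hi k k≢i with ℕ.<-cmp k i
  ... | tri< k<i _ _ = trans (after (ℕ.≤-trans offset≤t (ℕ.n≤1+n t))) (sym (after offset≤t))
    where
    offset≤t : offset (suc k) ≤ t
    offset≤t = ℕ.≤-trans (total-mono width k<i) lo
  ... | tri≈ _ k≡i _ = ⊥-elim (k≢i k≡i)
  ... | tri> _ _ i<k = trans (before t<offset) (sym (before (ℕ.<⇒≤ t<offset)))
    where
    t<offset : t < offset k
    t<offset = ℕ.≤-trans hi (total-mono width i<k)

  -- Row `suc i` receives boxes only once row `i` is full. So either the lower row still agrees with
  -- `κ` or the upper one already agrees with `ν`.
  chainPart-decreasing : ∀ t i → chainPart t (suc i) ≤ chainPart t i
  chainPart-decreasing t i with ℕ.≤-total t (offset (suc i))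
  ... | inj₁ t≤ = ℕ.≤-trans (ℕ.≤-reflexive (before {t} {suc i} t≤))
    (ℕ.≤-trans (Partition.decreasing κ i) (κ≤chainPart t i))
  ... | inj₂ ≤t = ℕ.≤-trans (chainPart≤ν t (suc i))
    (ℕ.≤-trans (Partition.decreasing ν i) (ℕ.≤-reflexive (sym (after {t} {i} ≤t))))

  chain : ℕ → Partition
  chain t = record
    { part       = chainPart t
    ; decreasing = chainPart-decreasing t
    ; bound      = Partition.bound ν
    ; vanishing  = λ i h → ℕ.n≤0⇒n≡0 (subst (chainPart t i ≤_)
        (Partition.vanishing ν i h) (chainPart≤ν t i))
    }

  -- The search goes up from the last row; rows without boxes own no step and are passed over.
  active-row : ∀ m {t} → t < offset m → ∃[ i ] i < m × offset i ≤ t × t < offset (suc i)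
  active-row (suc m) {t} t<offset with ℕ.≤-total (offset m) t
  ... | inj₁ lo = m , ℕ.≤-refl , lo , t<offset
  ... | inj₂ t≤ with ℕ.m≤n⇒m<n∨m≡n t≤
  ... | inj₂ eq = m , ℕ.≤-refl , ℕ.≤-reflexive (sym eq) , t<offset
  ... | inj₁ t< with active-row m t<
  ... | i , i<m , lo , hi = i , ℕ.m<n⇒m<1+n i<m , lo , hi

  -- The corner sum at the box added in step t tells the stages up to t from the later ones.
  detects : ∀ {t i} → offset i ≤ t → t < offset (suc i) → ∀ s →
    (chainPart s i ≤ᵇ chainPart t i) ≡ (s ≤ᵇ t)
  detects {t} {i} lo hi s with s ℕ.≤? t
  ... | yes s≤t = trans (≤⇒≤ᵇ≡true (chainPart-mono s≤t i)) (sym (≤⇒≤ᵇ≡true s≤t))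
  ... | no  s≰t = trans (≰⇒≤ᵇ≡false (ℕ.<⇒≱ (subst (_≤ chainPart s i) (step lo hi)
    (chainPart-mono (ℕ.≰⇒> s≰t) i)))) (sym (≰⇒≤ᵇ≡false s≰t))

  chainPart<ν : ∀ {t i} → offset i ≤ t → t < offset (suc i) → chainPart t i < part ν i
  chainPart<ν {t} {i} lo hi = subst (_≤ part ν i) (step lo hi) (chainPart≤ν (suc t) i)

  meet : Partition → ℕ → ℕ → ℕ
  meet μ t k = part μ k ⊓ chainPart t k

  -- Only row `i` of the chain changes. If `μ` is longer there, the meet follows the chain;
  -- otherwise the meet has already stopped at `μ`.
  meet-step : ∀ μ {t i} → offset i ≤ t → t < offset (suc i) →
    (∀ k → meet μ (suc t) k ≡ meet μ t k) ⊎
    (∀ k → (meet μ (suc t) k ≡ meet μ t k × chainPart (suc t) k ≡ chainPart t k) ⊎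
           (meet μ (suc t) k ≡ chainPart (suc t) k × meet μ t k ≡ chainPart t k))
  meet-step μ {t} {i} lo hi with chainPart t i ℕ.<? part μ i
  ... | yes c<μ = inj₂ λ k → at k (k ℕ.≟ i)
    where
    at : ∀ k → Dec (k ≡ i) → _
    at k (no k≢i)   = inj₁ (cong (part μ k ⊓_) (stays lo hi k k≢i) , stays lo hi k k≢i)
    at k (yes refl) = inj₂ (ℕ.m≥n⇒m⊓n≡n (subst (_≤ part μ i) (sym (step lo hi)) c<μ) ,
      ℕ.m≥n⇒m⊓n≡n (ℕ.<⇒≤ c<μ))
  ... | no c≮μ = inj₁ λ k → at k (k ℕ.≟ i)
    where
    μ≤c : part μ i ≤ chainPart t i
    μ≤c = ℕ.≮⇒≥ c≮μ
    at : ∀ k → Dec (k ≡ i) → meet μ (suc t) k ≡ meet μ t k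
    at k (no k≢i)   = cong (part μ k ⊓_) (stays lo hi k k≢i)
    at k (yes refl) = trans (ℕ.m≤n⇒m⊓n≡m (ℕ.≤-trans μ≤c (chainPart-mono (ℕ.n≤1+n t) i)))
      (sym (ℕ.m≤n⇒m⊓n≡m μ≤c))

  -- The additive form shows that the difference of sizes giving the dimension is not truncated.
  κ+offset : ∀ k → total (part κ) k ℕ.+ offset k ≡ total (part ν) k
  κ+offset zero    = refl
  κ+offset (suc k) = begin
    (total (part κ) k ℕ.+ part κ k) ℕ.+ (offset k ℕ.+ width k)
      ≡⟨ interchange (total (part κ) k) (part κ k) (offset k) (width k) ⟩
    (total (part κ) k ℕ.+ offset k) ℕ.+ (part κ k ℕ.+ width k)
      ≡⟨ cong₂ ℕ._+_ (κ+offset k) (κ+width≡ν k) ⟩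
    total (part ν) k ℕ.+ part ν k ∎
    where
    open ≡-Reasoning
    open CommutativeSemigroupProperties ℕ.+-commutativeSemigroup using (interchange)

  offset≡size : ∀ k → (∀ l → k ≤ l → part ν l ≡ 0) → offset k ≡ size ν ∸ size κ
  offset≡size k ν₀ = sym (trans (cong₂ _∸_ (trans (size≡total ν k ν₀) (sym (κ+offset k)))
    (size≡total κ k λ l k≤l → ℕ.n≤0⇒n≡0 (subst (part κ l ≤_) (ν₀ l k≤l) (κ⊆ν l))))
    (ℕ.m+n∸m≡n (total (part κ) k) (offset k)))

-- Convex geometry over an ordered semiring

-- The facts about the reals on which the convex geometry rests, kept abstract so that Cauchy
-- sequences stay out of it. Negative scalars come from integers through `ι`, and cancellation
-- stands in for subtraction.
record OrderedSemiring : Set₁ where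
  field
    rawSemiring : RawSemiring 0ℓ 0ℓ

  open RawSemiring rawSemiring

  infix 4 _≼_

  field
    isCommutativeSemiring : IsCommutativeSemiring _≈_ _+_ _*_ 0# 1#
    _≼_         : Rel Carrier 0ℓ
    ≼-reflexive : ∀ {x y} → x ≈ y → x ≼ y
    ≼-trans     : ∀ {x y z} → x ≼ y → y ≼ z → x ≼ z
    ≼-antisym   : ∀ {x y} → x ≼ y → y ≼ x → x ≈ y
    +-mono-≼    : ∀ {x y u v} → x ≼ y → u ≼ v → x + u ≼ y + v
    +-cancelʳ   : ∀ {x y} z → x + z ≈ y + z → x ≈ y
    0≼1         : 0# ≼ 1#
    ι           : ℤ → Carrier
    ι-+         : ∀ a b → ι (a ℤ.+ b) ≈ ι a + ι b
    ι-*         : ∀ a b → ι (a ℤ.* b) ≈ ι a * ι b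
    ι-0         : ι 0ℤ ≈ 0#
    ι-1         : ι 1ℤ ≈ 1#

  commutativeSemiring : CommutativeSemiring 0ℓ 0ℓ
  commutativeSemiring = record { isCommutativeSemiring = isCommutativeSemiring }

module Geometry (𝓡 : OrderedSemiring) where

  open OrderedSemiring 𝓡
  open CommutativeSemiring commutativeSemiring
    using (Carrier; _≈_; _+_; _*_; 0#; 1#; semiring; setoid; reflexive;
      +-comm; +-cong; +-congˡ; +-congʳ; +-identityˡ; +-identityʳ;
      *-comm; *-assoc; *-congˡ; *-congʳ; *-identityˡ; *-identityʳ; distribˡ; zeroˡ; zeroʳ)
    renaming (refl to ≈-refl; sym to ≈-sym; trans to ≈-trans)

  private
    module G = ConvexGeometry rawSemiring _≼_
    module Σ = SemiringSum semiring
    open SetoidReasoning setoid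

  ι-matrix : ∀ {m n} → Matrix ℤ m n → Matrix Carrier m n
  ι-matrix M i j = ι (M i j)

  ι-sum : ∀ {k} (v : Vector ℤ k) → ι (sum v) ≈ Σ.sum (λ s → ι (v s))
  ι-sum {zero}  v = ι-0
  ι-sum {suc k} v = ≈-trans (ι-+ (v zero) (sum (tail v))) (+-congˡ (ι-sum (tail v)))

  ι-cong : ∀ {a b} → a ≡ b → ι a ≈ ι b
  ι-cong eq = reflexive (cong ι eq)

  x≼x+y : ∀ {x y} → 0# ≼ y → x ≼ x + y
  x≼x+y 0≼y = ≼-trans (≼-reflexive (≈-sym (+-identityʳ _))) (+-mono-≼ (≼-reflexive ≈-refl) 0≼y)

  0≼+ : ∀ {x y} → 0# ≼ x → 0# ≼ y → 0# ≼ x + y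
  0≼+ 0≼x 0≼y = ≼-trans 0≼x (x≼x+y 0≼y)

  x+y≈0⇒x≈0 : ∀ {x y} → 0# ≼ x → 0# ≼ y → x + y ≈ 0# → x ≈ 0#
  x+y≈0⇒x≈0 0≼x 0≼y eq = ≼-antisym (≼-trans (x≼x+y 0≼y) (≼-reflexive eq)) 0≼x

  sum-nonneg : ∀ {k} {f : Vector Carrier k} → (∀ s → 0# ≼ f s) → 0# ≼ Σ.sum f
  sum-nonneg {zero}  h = ≼-reflexive ≈-refl
  sum-nonneg {suc k} h = 0≼+ (h zero) (sum-nonneg (h ∘ suc))

  sum≈0⇒≈0 : ∀ {k} {f : Vector Carrier k} → (∀ s → 0# ≼ f s) → Σ.sum f ≈ 0# → ∀ s → f s ≈ 0#
  sum≈0⇒≈0 h eq zero = x+y≈0⇒x≈0 (h zero) (sum-nonneg (h ∘ suc)) eq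
  sum≈0⇒≈0 h eq (suc s) = sum≈0⇒≈0 (h ∘ suc)
    (x+y≈0⇒x≈0 (sum-nonneg (h ∘ suc)) (h zero) (≈-trans (+-comm _ _) eq)) s

  *ι-suc : ∀ a n → a * ι (+ suc n) ≈ a + a * ι (+ n)
  *ι-suc a n = begin
    a * ι (1ℤ ℤ.+ + n)      ≈⟨ *-congˡ (≈-trans (ι-+ 1ℤ (+ n)) (+-congʳ ι-1)) ⟩
    a * (1# + ι (+ n))      ≈⟨ distribˡ a 1# (ι (+ n)) ⟩
    a * 1# + a * ι (+ n)    ≈⟨ +-congʳ (*-identityʳ a) ⟩
    a + a * ι (+ n)         ∎

  -- Multiplication by a natural number is repeated addition, so this reduces to monotonicity of
  -- addition.
  *ι-nonneg : ∀ {a} → 0# ≼ a → ∀ n → 0# ≼ a * ι (+ n)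
  *ι-nonneg {a} 0≼a zero    = ≼-reflexive (≈-sym (≈-trans (*-congˡ ι-0) (zeroʳ a)))
  *ι-nonneg {a} 0≼a (suc n) = ≼-trans (0≼+ 0≼a (*ι-nonneg 0≼a n)) (≼-reflexive (≈-sym (*ι-suc a n)))

  -- The product is `a` plus a nonnegative remainder, so antisymmetry squeezes `a` to zero without
  -- any division.
  *ι-suc≈0⇒≈0 : ∀ {a} → 0# ≼ a → ∀ n → a * ι (+ suc n) ≈ 0# → a ≈ 0#
  *ι-suc≈0⇒≈0 {a} 0≼a n eq = x+y≈0⇒x≈0 0≼a (*ι-nonneg 0≼a n) (≈-trans (≈-sym (*ι-suc a n)) eq)

  weighted : ∀ {k} → Vector Carrier k → Vector ℤ k → Carrier
  weighted a v = Σ.sum (λ s → a s * ι (v s))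

  weighted-+ : ∀ {k} (a : Vector Carrier k) (v w : Vector ℤ k) →
    weighted a (λ s → v s ℤ.+ w s) ≈ weighted a v + weighted a w
  weighted-+ a v w = ≈-trans
    (Σ.sum-cong-≋ λ s → ≈-trans (*-congˡ (ι-+ (v s) (w s))) (distribˡ (a s) (ι (v s)) (ι (w s))))
    (Σ.∑-distrib-+ (λ s → a s * ι (v s)) (λ s → a s * ι (w s)))

  weighted-const : ∀ {k} (a : Vector Carrier k) → Σ.sum a ≈ 1# → ∀ b → weighted a (λ _ → b) ≈ ι b
  weighted-const a eq b = ≈-trans (≈-sym (Σ.*-distribʳ-sum (ι b) a))
    (≈-trans (*-congʳ eq) (*-identityˡ (ι b)))

  module _ {m n : ℕ} where

    ⟨,⟩-cong : ∀ (c : Matrix Carrier m n) {x y} → x G.≋ y → G.⟨ c , x ⟩ ≈ G.⟨ c , y ⟩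
    ⟨,⟩-cong c x≋y = Σ.sum-cong-≋ λ i → Σ.sum-cong-≋ λ j → *-congˡ (x≋y i j)

    ⟨,ι⟩ : ∀ (c M : Matrix ℤ m n) → G.⟨ ι-matrix c , ι-matrix M ⟩ ≈ ι ℤ⟨ c , M ⟩
    ⟨,ι⟩ c M = ≈-sym (≈-trans (ι-sum {m} (λ i → sum (λ j → c i j ℤ.* M i j))) (Σ.sum-cong-≋ λ i →
      ≈-trans (ι-sum {n} (λ j → c i j ℤ.* M i j)) (Σ.sum-cong-≋ λ j → ι-* (c i j) (M i j))))

    ⟨,⟩-linearCombination : ∀ (c : Matrix Carrier m n) {k} (a : Vector Carrier k) p →
      G.⟨ c , G.linearCombination a p ⟩ ≈ Σ.sum (λ s → a s * G.⟨ c , p s ⟩)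
    ⟨,⟩-linearCombination c {k} a p = begin
      Σ.sum (λ i → Σ.sum (λ j → c i j * Σ.sum (λ s → a s * p s i j)))
        ≈⟨ Σ.sum-cong-≋ (λ i → ≈-trans (Σ.sum-cong-≋ λ j → expand i j)
             (Σ.∑-comm {n} {k} (λ j s → a s * (c i j * p s i j)))) ⟩
      Σ.sum (λ i → Σ.sum (λ s → Σ.sum (λ j → a s * (c i j * p s i j))))
        ≈⟨ Σ.∑-comm {m} {k} (λ i s → Σ.sum (λ j → a s * (c i j * p s i j))) ⟩
      Σ.sum (λ s → Σ.sum (λ i → Σ.sum (λ j → a s * (c i j * p s i j))))
        ≈⟨ Σ.sum-cong-≋ (λ s → ≈-trans (Σ.sum-cong-≋ λ i →
               ≈-sym (Σ.*-distribˡ-sum {n} (a s) (λ j → c i j * p s i j)))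
             (≈-sym (Σ.*-distribˡ-sum {m} (a s) (λ i → Σ.sum (λ j → c i j * p s i j))))) ⟩
      Σ.sum (λ s → a s * G.⟨ c , p s ⟩) ∎
      where
      expand : ∀ i j → c i j * Σ.sum (λ s → a s * p s i j) ≈ Σ.sum (λ s → a s * (c i j * p s i j))
      expand i j = ≈-trans (Σ.*-distribˡ-sum {k} (c i j) (λ s → a s * p s i j)) (Σ.sum-cong-≋ λ s →
        ≈-trans (≈-sym (*-assoc (c i j) (a s) (p s i j)))
          (≈-trans (*-congʳ (*-comm (c i j) (a s))) (*-assoc (a s) (c i j) (p s i j))))

    -- Zero-testing real weights is impossible, but the integral slack b − ⟨ c , M ⟩ of a
    -- vertex M is decidable: where it is nonzero the weight is forced to be zero, and
    -- the vertex may be replaced by x₀.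
    module Face (F S : Pred (Matrix Carrier m n) 0ℓ) (c : Matrix ℤ m n) (b : ℤ)
      (bounded : ∀ x → S x → Σ[ M ∈ Matrix ℤ m n ]
        x G.≋ ι-matrix M × ℤ⟨ c , M ⟩ ℤ.≤ b × (ℤ⟨ c , M ⟩ ≡ b → F x))
      (attained : ∀ x → F x → S x × Σ[ M ∈ Matrix ℤ m n ] x G.≋ ι-matrix M × ℤ⟨ c , M ⟩ ≡ b)
      (x₀ : Matrix Carrier m n) (Fx₀ : F x₀) where

      private
        value : ∀ x {M} → x G.≋ ι-matrix M → G.⟨ ι-matrix c , x ⟩ ≈ ι ℤ⟨ c , M ⟩
        value x {M} eq = ≈-trans (⟨,⟩-cong (ι-matrix c) eq) (⟨,ι⟩ c M)

      module _ {x} (x∈S : G.conv S x) where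

        private
          k = proj₁ x∈S
          a = proj₁ (proj₂ x∈S)
          p = proj₁ (proj₂ (proj₂ x∈S))
          p∈S = proj₁ (proj₂ (proj₂ (proj₂ x∈S)))
          0≼a = proj₁ (proj₂ (proj₂ (proj₂ (proj₂ x∈S))))
          Σa≈1 = proj₁ (proj₂ (proj₂ (proj₂ (proj₂ (proj₂ x∈S)))))
          x≋ = proj₂ (proj₂ (proj₂ (proj₂ (proj₂ (proj₂ x∈S)))))

          M : Fin k → Matrix ℤ m n
          M s = proj₁ (bounded (p s) (p∈S s))

          v : Vector ℤ k
          v s = ℤ⟨ c , M s ⟩

          -- The absolute value makes the slack a natural number; it is the difference itself
          -- because `v s` is at most `b`.
          slack : Fin k → ℕ
          slack s = ℤ.∣ b ℤ.- v s ∣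

          v+slack : ∀ s → v s ℤ.+ + slack s ≡ b
          v+slack s = trans (cong (ℤ._+_ (v s))
            (ℤ.0≤i⇒+∣i∣≡i (ℤ.i≤j⇒0≤j-i (proj₁ (proj₂ (proj₂ (bounded (p s) (p∈S s))))))))
            (cancel (v s) b)
            where
            open ℤ-Solver.+-*-Solver
            cancel : ∀ x y → x ℤ.+ (y ℤ.- x) ≡ y
            cancel = solve 2 (λ x y → x :+ (y :- x) := y) refl

          -- Averages `v+slack` with the weights of `x`. It yields both the bound on the functional
          -- and, when that bound is tight, the vanishing of every weighted slack.
          value+slack : G.⟨ ι-matrix c , x ⟩ + weighted a (λ s → + slack s) ≈ ι b
          value+slack = begin
            G.⟨ ι-matrix c , x ⟩ + weighted a (λ s → + slack s)
              ≈⟨ +-congʳ (≈-trans (⟨,⟩-cong (ι-matrix c) x≋)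
                   (≈-trans (⟨,⟩-linearCombination (ι-matrix c) a p) (Σ.sum-cong-≋ λ s →
                   *-congˡ (value (p s) (proj₁ (proj₂ (bounded (p s) (p∈S s)))))))) ⟩
            weighted a v + weighted a (λ s → + slack s)
              ≈⟨ weighted-+ a v (λ s → + slack s) ⟨
            weighted a (λ s → v s ℤ.+ + slack s)
              ≈⟨ Σ.sum-cong-≋ (λ s → *-congˡ (ι-cong (v+slack s))) ⟩
            weighted a (λ _ → b)
              ≈⟨ weighted-const a Σa≈1 b ⟩
            ι b ∎

          terms-nonneg : ∀ s → 0# ≼ a s * ι (+ slack s)
          terms-nonneg s = *ι-nonneg (0≼a s) (slack s)

        below : G.⟨ ι-matrix c , x ⟩ ≼ ι b
        below = ≼-trans (x≼x+y (sum-nonneg terms-nonneg)) (≼-reflexive value+slack)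

        module _ (tight : G.⟨ ι-matrix c , x ⟩ ≈ ι b) where

          private
            a*slack≈0 : ∀ s → a s * ι (+ slack s) ≈ 0#
            a*slack≈0 = sum≈0⇒≈0 terms-nonneg (+-cancelʳ (ι b)
              (≈-trans (+-comm _ _) (≈-trans (+-congʳ (≈-sym tight))
                (≈-trans value+slack (≈-sym (+-identityˡ (ι b)))))))

            replace : ∀ s → Σ[ q ∈ Matrix Carrier m n ] F q × (∀ i j → a s * p s i j ≈ a s * q i j)
            replace s = by-slack (slack s) refl
              where
              by-slack : ∀ l → slack s ≡ l →
                Σ[ q ∈ Matrix Carrier m n ] F q × (∀ i j → a s * p s i j ≈ a s * q i j)
              by-slack zero eq = p s , proj₂ (proj₂ (proj₂ (bounded (p s) (p∈S s))))
                (trans (sym (ℤ.+-identityʳ (v s)))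
                  (trans (cong (λ l → v s ℤ.+ + l) (sym eq)) (v+slack s)))
                , λ i j → ≈-refl
              by-slack (suc l) eq = x₀ , Fx₀ , λ i j → ≈-trans (*-congʳ a≈0)
                (≈-trans (zeroˡ _) (≈-sym (≈-trans (*-congʳ a≈0) (zeroˡ _))))
                where
                a≈0 : a s ≈ 0#
                a≈0 = *ι-suc≈0⇒≈0 (0≼a s) l (subst (λ l → a s * ι (+ l) ≈ 0#) eq (a*slack≈0 s))

          in-face : G.conv F x
          in-face = k , a , (λ s → proj₁ (replace s)) ,
            (λ s → proj₁ (proj₂ (replace s))) , 0≼a , Σa≈1 ,
            λ i j → ≈-trans (x≋ i j) (Σ.sum-cong-≋ λ s → proj₂ (proj₂ (replace s)) i j)

      isFace : G.IsFaceOf (G.conv F) (G.conv S)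
      isFace = ι-matrix c , ι b , (λ x x∈S → below x∈S) ,
        (λ {x} (k , a , p , p∈F , 0≼a , Σa≈1 , x≋) →
          (k , a , p , (λ s → proj₁ (attained (p s) (p∈F s))) , 0≼a , Σa≈1 , x≋) ,
          (begin
            G.⟨ ι-matrix c , x ⟩                       ≈⟨ ⟨,⟩-cong (ι-matrix c) x≋ ⟩
            G.⟨ ι-matrix c , G.linearCombination a p ⟩ ≈⟨ ⟨,⟩-linearCombination (ι-matrix c) a p ⟩
            Σ.sum (λ s → a s * G.⟨ ι-matrix c , p s ⟩) ≈⟨ Σ.sum-cong-≋ (λ s → *-congˡ
                                                            (at-b (attained (p s) (p∈F s)))) ⟩
            weighted a (λ _ → b)                       ≈⟨ weighted-const a Σa≈1 b ⟩
            ι b                                        ∎)) ,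
        λ (x∈S , tight) → in-face x∈S tight
        where
        at-b : ∀ {y} → S y × Σ[ M ∈ Matrix ℤ m n ] y G.≋ ι-matrix M × ℤ⟨ c , M ⟩ ≡ b →
          G.⟨ ι-matrix c , y ⟩ ≈ ι b
        at-b {y} (_ , M , y≋M , eq) = ≈-trans (value y y≋M) (ι-cong eq)

    module Span {d : ℕ} (q : Vector (Matrix Carrier m n) d) where

      -- The affine hull of the fixed family `q` with one coefficient per member, whereas `aff`
      -- allows arbitrary finite lists of points.
      InSpan : Pred (Matrix Carrier m n) 0ℓ
      InSpan x = Σ[ α ∈ Vector Carrier d ] Σ.sum α ≈ 1# × x G.≋ G.linearCombination α q

      span-resp-≋ : ∀ {x y} → x G.≋ y → InSpan x → InSpan y
      span-resp-≋ x≋y (α , Σα≈1 , x≋) = α , Σα≈1 , λ i j → ≈-trans (≈-sym (x≋y i j)) (x≋ i j)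

      -- Coefficients of nested combinations compose like matrix products, and the total stays 1.
      span-combination : ∀ {k} (a : Vector Carrier k) (p : Vector (Matrix Carrier m n) k) →
        (∀ l → InSpan (p l)) → Σ.sum a ≈ 1# → InSpan (G.linearCombination a p)
      span-combination {k} a p p∈ Σa≈1 = (λ s → Σ.sum (λ l → a l * α l s)) ,
        (begin
          Σ.sum (λ s → Σ.sum (λ l → a l * α l s))
            ≈⟨ Σ.∑-comm {d} {k} (λ s l → a l * α l s) ⟩
          Σ.sum (λ l → Σ.sum (λ s → a l * α l s))
            ≈⟨ Σ.sum-cong-≋ (λ l → ≈-trans (≈-sym (Σ.*-distribˡ-sum (a l) (α l)))
                 (≈-trans (*-congˡ (proj₁ (proj₂ (p∈ l)))) (*-identityʳ (a l)))) ⟩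
          Σ.sum a
            ≈⟨ Σa≈1 ⟩
          1# ∎) ,
        λ i j → begin
          Σ.sum (λ l → a l * p l i j)
            ≈⟨ Σ.sum-cong-≋ (λ l → ≈-trans (*-congˡ (proj₂ (proj₂ (p∈ l)) i j))
                 (≈-trans (Σ.*-distribˡ-sum {d} (a l) (λ s → α l s * q s i j))
                   (Σ.sum-cong-≋ λ s → ≈-sym (*-assoc (a l) (α l s) (q s i j))))) ⟩
          Σ.sum (λ l → Σ.sum (λ s → (a l * α l s) * q s i j))
            ≈⟨ Σ.∑-comm {k} {d} (λ l s → (a l * α l s) * q s i j) ⟩
          Σ.sum (λ s → Σ.sum (λ l → (a l * α l s) * q s i j))
            ≈⟨ Σ.sum-cong-≋ (λ s → ≈-sym (Σ.*-distribʳ-sum {k} (q s i j) (λ l → a l * α l s))) ⟩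
          Σ.sum (λ s → Σ.sum (λ l → a l * α l s) * q s i j) ∎
        where
        α : Fin k → Vector Carrier d
        α l = proj₁ (p∈ l)

      span-ℤ-combination : ∀ {k} (v : Vector ℤ k) (P : Vector (Matrix ℤ m n) k) (M : Matrix ℤ m n) →
        (∀ l → InSpan (ι-matrix (P l))) → sum v ≡ 1ℤ →
        (∀ i j → sum (λ l → v l ℤ.* P l i j) ≡ M i j) → InSpan (ι-matrix M)
      span-ℤ-combination {k} v P M P∈ Σv≡1 eq = span-resp-≋
        (λ i j → ≈-trans (Σ.sum-cong-≋ λ l → ≈-sym (ι-* (v l) (P l i j)))
          (≈-trans (≈-sym (ι-sum {k} (λ l → v l ℤ.* P l i j))) (ι-cong (eq i j))))
        (span-combination (λ l → ι (v l)) (λ l → ι-matrix (P l)) P∈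
          (≈-trans (≈-sym (ι-sum v)) (≈-trans (ι-cong Σv≡1) ι-1)))

      span-shift : ∀ (M P Q M′ : Matrix ℤ m n) →
        InSpan (ι-matrix M) → InSpan (ι-matrix P) → InSpan (ι-matrix Q) →
        (∀ i j → M′ i j ≡ M i j ℤ.+ (P i j ℤ.- Q i j)) → InSpan (ι-matrix M′)
      span-shift M P Q M′ M∈ P∈ Q∈ eq = span-ℤ-combination
        -- The weights 1, 1, -1 add up to 1, so adding a difference of two points of the span is an
        -- affine combination.
        (1ℤ ∷ᵥ 1ℤ ∷ᵥ -1ℤ ∷ᵥ []ᵥ) (M ∷ᵥ P ∷ᵥ Q ∷ᵥ []ᵥ) M′
        (λ { zero → M∈ ; (suc zero) → P∈ ; (suc (suc zero)) → Q∈ }) refl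
        λ i j → trans (expand (M i j) (P i j) (Q i j)) (sym (eq i j))
        where
        open ℤ-Solver.+-*-Solver
        expand : ∀ x y z → 1ℤ ℤ.* x ℤ.+ (1ℤ ℤ.* y ℤ.+ (-1ℤ ℤ.* z ℤ.+ 0ℤ)) ≡ x ℤ.+ (y ℤ.- z)
        expand = solve 3 (λ x y z →
          con 1ℤ :* x :+ (con 1ℤ :* y :+ (con -1ℤ :* z :+ con 0ℤ)) := x :+ (y :- z)) refl

    select : ∀ {d} (q : Vector (Matrix Carrier m n) d) s → Span.InSpan q (q s)
    select {suc d} q zero = (1# ∷ᵥ λ _ → 0#) ,
      ≈-trans (+-congˡ (Σ.sum-replicate-zero d)) (+-identityʳ 1#) ,
      λ i j → ≈-sym (≈-trans (+-cong (*-identityˡ (q zero i j))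
        (≈-trans (Σ.sum-cong-≋ λ s → zeroˡ (q (suc s) i j)) (Σ.sum-replicate-zero d)))
        (+-identityʳ (q zero i j)))
    select {suc d} q (suc s) with select (tail q) s
    ... | α , Σα≈1 , eq = (0# ∷ᵥ α) , ≈-trans (+-identityˡ _) Σα≈1 ,
      λ i j → ≈-trans (eq i j) (≈-sym (≈-trans (+-congʳ (zeroˡ (q zero i j))) (+-identityˡ _)))

    -- The affine hulls of `q` and of `conv F` agree: each `q s` is a one-term convex combination,
    -- and a combination of points spanned by `q` is again spanned by `q`.
    hasDimension : ∀ (F : Pred (Matrix Carrier m n) 0ℓ) {d}
      (q : Vector (Matrix Carrier m n) (suc d)) → G.AffinelyIndependent q → (∀ s → F (q s)) → (∀ x → F x → Span.InSpan q x) →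
      G.HasDimension (G.conv F) d
    hasDimension F {d} q independent q∈F F⊆span = q , independent ,
      (λ (k , a , p , p∈ , Σa≈1 , x≋) → k , a , p , (λ l → vertex (p∈ l)) , Σa≈1 , x≋) ,
      (λ (k , a , p , p∈ , Σa≈1 , x≋) → affine
        (span-resp-≋ (λ i j → ≈-sym (x≋ i j)) (span-combination a p (λ l → convex (p∈ l)) Σa≈1)))
      where
      open Span q
      vertex : ∀ {y} → ∃[ s ] y G.≋ q s → G.conv F y
      vertex (s , y≋) = 1 , (λ _ → 1#) , (λ _ → q s) , (λ _ → q∈F s) , (λ _ → 0≼1) , +-identityʳ 1# ,
        λ i j → ≈-trans (y≋ i j) (≈-sym (≈-trans (+-identityʳ _) (*-identityˡ (q s i j))))
      convex : ∀ {y} → G.conv F y → InSpan y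
      convex (k , a , p , p∈F , _ , Σa≈1 , y≋) =
        span-resp-≋ (λ i j → ≈-sym (y≋ i j)) (span-combination a p (λ l → F⊆span (p l) (p∈F l)) Σa≈1)
      affine : ∀ {y} → InSpan y → G.aff (λ y → ∃[ s ] y G.≋ q s) y
      affine (α , Σα≈1 , y≋) = suc d , α , q , (λ s → s , λ i j → ≈-refl) , Σα≈1 , y≋

  -- Applied once along columns and once along rows, it carries a linear relation between matrices
  -- over to their corner sums.
  weighted-prefix : ∀ {k n} (a : Vector Carrier k) (g : Fin k → Vector ℤ n) →
    (∀ j → weighted a (λ s → g s j) ≈ 0#) → ∀ j → weighted a (λ s → prefix (g s) j) ≈ 0#
  weighted-prefix a g h zero    = h zero
  weighted-prefix a g h (suc j) = ≈-trans (weighted-+ a (λ s → g s zero) (λ s → prefix (tail (g s)) j))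
    (≈-trans (+-cong (h zero) (weighted-prefix a (λ s → tail (g s)) (h ∘ suc) j)) (+-identityˡ 0#))

  -- At `t = 0` only the first coefficient is counted. Once it is zero, the remaining equations are
  -- those of the tail with `t` lowered by one.
  triangular : ∀ {k} (a : Vector Carrier k) →
    (∀ t → t < k → weighted a (λ s → ⟦ toℕ s ≤ᵇ t ⟧) ≈ 0#) → ∀ s → a s ≈ 0#
  triangular {suc k} a h = λ { zero → a₀≈0 ; (suc s) → triangular (tail a) rest s }
    where
    a₀≈0 : a zero ≈ 0#
    a₀≈0 = begin
      a zero
        ≈⟨ ≈-trans (+-identityʳ _) (≈-trans (*-congˡ ι-1) (*-identityʳ _)) ⟨
      a zero * ι 1ℤ + 0#
        ≈⟨ +-congˡ (≈-trans (Σ.sum-cong-≋ λ s → ≈-trans (*-congˡ ι-0) (zeroʳ (a (suc s))))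
             (Σ.sum-replicate-zero k)) ⟨
      weighted a (λ s → ⟦ toℕ s ≤ᵇ 0 ⟧)
        ≈⟨ h 0 (s≤s z≤n) ⟩
      0# ∎
    rest : ∀ t → t < k → weighted (tail a) (λ s → ⟦ toℕ s ≤ᵇ t ⟧) ≈ 0#
    rest t t<k = begin
      weighted (tail a) (λ s → ⟦ toℕ s ≤ᵇ t ⟧)
        ≈⟨ Σ.sum-cong-≋ {k} (λ s → *-congˡ {a (suc s)} (ι-cong (cong ⟦_⟧ (sym (suc-≤ᵇ-suc (toℕ s) t))))) ⟩
      Σ.sum (λ s → a (suc s) * ι ⟦ suc (toℕ s) ≤ᵇ suc t ⟧)
        ≈⟨ ≈-trans (+-congʳ (≈-trans (*-congʳ a₀≈0) (zeroˡ _))) (+-identityˡ _) ⟨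
      weighted a (λ s → ⟦ toℕ s ≤ᵇ suc t ⟧)
        ≈⟨ h (suc t) (s≤s t<k) ⟩
      0# ∎

  -- Face property and dimension of the skew polytope

  module Skew (m n : ℕ) (κ ν : Partition) (κ⊆ν : κ ⊆ ν)
    (ν-vanishing : ∀ k → suc m ≤ k → part ν k ≡ 0) (ν₀≤n : part ν 0 ≤ n) where

    open SupportingFunctional m n κ ν ν-vanishing ν₀≤n κ⊆ν
      using (normal; normal≤1; module Tight; normal-partitionMatrix)
    open Chain κ ν κ⊆ν

    vertices asms : Pred (Matrix Carrier (suc m) (suc n)) 0ℓ
    vertices x = Σ[ μ ∈ Partition ] κ ⊆ μ × μ ⊆ ν × x G.≋ ι-matrix (partitionMatrix μ (suc m) (suc n))
    asms     x = Σ[ M ∈ Matrix ℤ (suc m) (suc n) ] IsPartialASM M × x G.≋ ι-matrix M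

    skew-isFace : G.IsFaceOf (G.conv vertices) (G.conv asms)
    skew-isFace = Face.isFace vertices asms normal 1ℤ
      (λ x (M , asm , x≋M) → M , x≋M , normal≤1 asm , λ tight →
        let open Tight asm tight in
        partition , κ⊆partition , partition⊆ν ,
        λ i j → ≈-trans (x≋M i j) (ι-cong (≡partitionMatrix i j)))
      (λ x (μ , κ⊆μ , μ⊆ν , x≋M) → let M = partitionMatrix μ (suc m) (suc n) in
        (M , partitionMatrix-isPartialASM μ (suc m) (suc n) , x≋M) ,
        M , x≋M , normal-partitionMatrix μ κ⊆μ μ⊆ν)
      -- The default vertex that takes over zero weights is the one of `κ`, which lies between `κ`
      -- and `ν`.
      (ι-matrix (partitionMatrix κ (suc m) (suc n)))
      (κ , (λ _ → ℕ.≤-refl) , κ⊆ν , λ i j → ≈-refl)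

    private
      d : ℕ
      d = offset (suc m)

      q : Vector (Matrix Carrier (suc m) (suc n)) (suc d)
      q s = ι-matrix (partitionMatrix (chain (toℕ s)) (suc m) (suc n))

      open Span q

      corner : Fin (suc d) → Matrix ℤ (suc m) (suc n)
      corner s i j =
        prefix (λ j′ → prefix (λ i′ → partitionMatrix (chain (toℕ s)) (suc m) (suc n) i′ j′) i) j

      corner≡ : ∀ s i j → corner s i j ≡ ⟦ chainPart (toℕ s) (toℕ i) ≤ᵇ toℕ j ⟧
      corner≡ s i j = trans
        (prefix-cong (λ j′ → trans
          (prefix-cong (λ i′ → partitionMatrix≡staircase (chain (toℕ s)) i′ j′) i)
          (staircase-column (chainPart (toℕ s)) i j′)) j)
        (prefix-unit (chainPart (toℕ s) (toℕ i)) j)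

    -- For `t < d` the equation required by `triangular` is the vanishing corner sum at the box
    -- added in step `t`. For `t = d` all points are counted, and the equation is the hypothesis
    -- that the coefficients sum to zero.
    chain-independent : G.AffinelyIndependent q
    chain-independent a Σa≈0 null = triangular a λ t t<1+d →
      prefix-weight t (ℕ.m≤n⇒m<n∨m≡n (ℕ.≤-pred t<1+d))
      where
      corner-sum : ∀ i j → weighted a (λ s → corner s i j) ≈ 0#
      corner-sum i = weighted-prefix a (λ s j → prefix (λ i′ → M s i′ j) i)
        λ j → weighted-prefix a (λ s i′ → M s i′ j) (λ i′ → null i′ j) i
        where
        M : Fin (suc d) → Matrix ℤ (suc m) (suc n)
        M s = partitionMatrix (chain (toℕ s)) (suc m) (suc n)

      prefix-weight : ∀ t → t < d ⊎ t ≡ d → weighted a (λ s → ⟦ toℕ s ≤ᵇ t ⟧) ≈ 0#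
      prefix-weight t (inj₂ t≡d) = ≈-trans
        (Σ.sum-cong-≋ {suc d} λ s → ≈-trans
          (*-congˡ {a s} (≈-trans (ι-cong (cong ⟦_⟧ (≤⇒≤ᵇ≡true (s≤t s)))) ι-1)) (*-identityʳ (a s)))
        Σa≈0
        where
        s≤t : ∀ s → toℕ s ≤ t
        s≤t s = subst (toℕ s ≤_) (sym t≡d) (ℕ.≤-pred (Fin.toℕ<n s))
      prefix-weight t (inj₁ t<d) with active-row (suc m) t<d
      ... | i , i<m , lo , hi = ≈-trans
        (Σ.sum-cong-≋ {suc d} λ s → *-congˡ {a s} (ι-cong (sym (trans (corner≡ s row column)
          (cong ⟦_⟧ (trans
            (cong₂ (λ k l → chainPart (toℕ s) k ≤ᵇ l) (Fin.toℕ-fromℕ< i<m) (Fin.toℕ-fromℕ< c<n))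
            (detects lo hi (toℕ s))))))))
        (corner-sum row column)
        where
        -- The box added in step `t`: with columns counted from 0, its column is the length of its
        -- row before the addition.
        row : Fin (suc m)
        row = fromℕ< i<m
        c<n : chainPart t i < suc n
        c<n = ℕ.m<n⇒m<1+n (ℕ.≤-trans (chainPart<ν lo hi)
          (ℕ.≤-trans (decreasing⇒≤ (Partition.decreasing ν) z≤n) ν₀≤n))
        column : Fin (suc n)
        column = fromℕ< c<n

    staircase∈span : (ℕ → ℕ) → Set
    staircase∈span f = InSpan (ι-matrix (staircase f (suc m) (suc n)))

    private
      respects : ∀ {f g} → (∀ k → k < suc m → f k ≡ g k) → staircase∈span f → staircase∈span g
      respects eq = span-resp-≋ λ i j → ι-cong (staircase-cong eq i j)

      chain∈span : ∀ t → t ≤ d → staircase∈span (chainPart t)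
      chain∈span t t≤d = respects (λ k _ → cong (λ t → chainPart t k) (Fin.toℕ-fromℕ< (s≤s t≤d)))
        (span-resp-≋ (λ i j → ι-cong (partitionMatrix≡staircase (chain (toℕ s)) i j)) (select q s))
        where
        s = fromℕ< (s≤s t≤d)

      -- Induction along the chain: the meet starts at `κ`, and each step either leaves it unchanged
      -- or adds a difference of consecutive chain matrices.
      meet∈span : ∀ μ → κ ⊆ μ → ∀ t → t ≤ d → staircase∈span (meet μ t)
      meet∈span μ κ⊆μ zero t≤d = respects
        (λ k _ → trans (before z≤n) (sym (trans (cong (part μ k ⊓_) (before z≤n))
          (ℕ.m≥n⇒m⊓n≡n (κ⊆μ k)))))
        (chain∈span zero t≤d)
      meet∈span μ κ⊆μ (suc t) t<d with active-row (suc m) t<d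
      ... | i , _ , lo , hi with meet-step μ lo hi
      ... | inj₁ same = respects (λ k _ → sym (same k)) (meet∈span μ κ⊆μ t (ℕ.<⇒≤ t<d))
      ... | inj₂ cases = span-shift _ _ _ _ (meet∈span μ κ⊆μ t (ℕ.<⇒≤ t<d)) (chain∈span (suc t) t<d)
        (chain∈span t (ℕ.<⇒≤ t<d)) (staircase-shift cases)

      -- After `d` steps the chain agrees with `ν` in every row of the matrix, so its meet with `μ`
      -- is `μ` there.
      vertex∈span : ∀ x → vertices x → InSpan x
      vertex∈span x (μ , κ⊆μ , μ⊆ν , x≋) = span-resp-≋
        (λ i j → ≈-sym (≈-trans (x≋ i j) (ι-cong (partitionMatrix≡staircase μ i j))))
        (respects (λ k k<m → trans (cong (part μ k ⊓_) (after (total-mono width k<m)))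
          (ℕ.m≤n⇒m⊓n≡m (μ⊆ν k)))
          (meet∈span μ κ⊆μ d ℕ.≤-refl))

    skew-hasDimension : G.HasDimension (G.conv vertices) (size ν ∸ size κ)
    skew-hasDimension = subst (G.HasDimension (G.conv vertices)) (offset≡size (suc m) ν-vanishing)
      (hasDimension vertices q chain-independent
        (λ s → chain (toℕ s) , κ≤chainPart (toℕ s) , chainPart≤ν (toℕ s) , λ i j → ≈-refl)
        vertex∈span)

-- Specialisation to the reals

fromℚ-0≤1 : fromℚ 0ℚ ≤ᴿ fromℚ 1ℚ
fromℚ-0≤1 = mk≤ λ ε 0<ε → 0 , λ _ _ → ℚ.<-trans (ℚ.positive⁻¹ 1ℚ) (<⇒<+ 1ℚ 0<ε)

ℝ-orderedSemiring : OrderedSemiring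
ℝ-orderedSemiring = record
  { rawSemiring           = ℝ-rawSemiring
  ; isCommutativeSemiring = +ᴿ-*ᴿ-isCommutativeSemiring
  ; _≼_                   = _≤ᴿ_
  ; ≼-reflexive           = ≤ᴿ-reflexive
  ; ≼-trans               = ≤ᴿ-trans
  ; ≼-antisym             = ≤ᴿ-antisym
  ; +-mono-≼              = +ᴿ-mono-≤
  ; +-cancelʳ             = +ᴿ-cancelʳ
  ; 0≼1                   = fromℚ-0≤1
  ; ι                     = fromℤ
  ; ι-+                   = fromℤ-+
  ; ι-*                   = fromℤ-*
  ; ι-0                   = ≈ᴿ-refl
  ; ι-1                   = ≈ᴿ-refl
  }

theorem2 : (m n : ℕ) → 1 ≤ m → 1 ≤ n → (κ ν : Partition) → κ ⊆ ν → ν ⊆ (n ∸ 1) ^ (m ∸ 1) →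
    IsFaceOf (skewPASM ν κ m n) (PASM m n) × HasDimension (skewPASM ν κ m n) (size ν ∸ size κ)
theorem2 (suc m) (suc n) _ _ κ ν κ⊆ν (ℓν≤m , ν₀≤n) = skew-isFace , skew-hasDimension
  where
  open Geometry.Skew ℝ-orderedSemiring m n κ ν κ⊆ν
    -- At most `m` positive parts means that parts vanish from index `m` on, in particular from
    -- `suc m` on.
    (λ k m<k → ℓ≤⇒vanishing ν m ℓν≤m k (ℕ.<⇒≤ m<k)) ν₀≤n
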